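{- For every $n\ge 1$ the genus distribution of ${\cal S}_3^n$ is unimodal, and its peak $p_3(n)$ is $$p_3(n)=\begin{cases}\Big[\dfrac{n-1}{2}\Big], & 1\le n\le 6,\\[2mm] 2, & n=7,\\[1mm] \Big[\dfrac{n+2}{3}\Big], & n\ge 8.\end{cases}$$
   Context: $[x]$ denotes the largest integer not exceeding $x$. A surface is represented by a cyclic word in which every occurring letter $x$ appears exactly once as $x$ and exactly once as $x^-$; it is the closed orientable surface obtained from a polygon with boundary labelled by the word by identifying each side $x$ with the side $x^-$ (orientation reversed), and its genus is the genus of that surface. Let $a_1,a_2,\dots$ be distinct letters. For $n\ge 1$ and subsets $K,T\subseteq\{1,\dots,n\}$ put: $R_1^n$ = product of the letters $a_k$, $k\in K$, in decreasing order of index; $R_2^n$ = product of the $a_k$, $k\notin K$, in increasing order of index; $R_3^n$ = product of the $a_t^-$, $t\in T$, in decreasing order of index; $R_4^n$ = product of the $a_t^-$, $t\notin T$, in increasing order of index. The set of ladder surfaces considered is ${\cal S}_3^n=\{R_1^nR_3^nR_2^nR_4^n\}$, where $(K,T)$ runs over all $4^n$ pairs of subsets and surfaces are counted with multiplicity (one for each pair). $g_{i_3}(n)$ is the number of surfaces of genus $i$ in ${\cal S}_3^n$, and the genus distribution of ${\cal S}_3^n$ is the sequence $(g_{i_3}(n))_i$, with $i$ running from the minimum to the maximum genus of surfaces in ${\cal S}_3^n$. A finite sequence of nonnegative numbers $\{a_i\}_{i=q}^n$ is unimodal if $a_q\le\cdots\le a_{l-1}<a_l=\cdots=a_m>a_{m+1}\ge\cdots\ge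 a_n$ for some $q\le l\le m\le n$; $l,\dots,m$ are its modes, and if $l=m$ then $m$ is called the peak (indices are genera). -}

module Defs where

open import Data.Bool.Base using (if_then_else_)
open import Data.Fin.Base using (Fin; toℕ)
open import Data.Fin.Properties using (any?) renaming (_≟_ to _≟ᶠ_)
open import Data.Fin.Subset using (Subset; inside; outside) renaming (_∈_ to _∈ˢ_)
open import Data.Fin.Subset.Properties using () renaming (_∈?_ to _∈ˢ?_)
open import Data.Integer.Base as ℤ using (ℤ; +_)
import Data.Integer.Properties as ℤ
open import Data.List.Base using (List; []; _∷_; _++_; map; filter; reverse; length; lookup; allFin; cartesianProduct; cartesianProductWith; deduplicate; foldr)
open import Data.List.Membership.Propositional using (_∈_)
open import Data.List.Membership.Propositional.Properties using (∈-filter⁺; ∈-filter⁻; ∈-map⁺; ∈-map⁻; ∈-++⁺ˡ; ∈-++⁺ʳ; ∈-++⁻; ∈-allFin; ∈-cartesianProduct⁺)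
open import Data.List.Relation.Binary.Disjoint.Propositional using (Disjoint)
open import Data.List.Relation.Binary.Permutation.Propositional using (↭-sym; ↭⇒↭ₛ)
open import Data.List.Relation.Binary.Permutation.Propositional.Properties using (↭-reverse)
import Data.List.Relation.Binary.Permutation.Setoid.Properties as Permutation
open import Data.List.Relation.Unary.All using (All)
open import Data.List.Relation.Unary.Any using (Any; here; there)
import Data.List.Relation.Unary.Any.Properties as Any
open import Data.List.Relation.Unary.Unique.Propositional using (Unique)
import Data.List.Relation.Unary.Unique.Propositional.Properties as Unique
open import Data.Nat.Base using (ℕ; zero; suc; _+_; _∸_; _/_; _≤_; _<_; ⌊_/2⌋; _≤ᵇ_; _≡ᵇ_)
open import Data.Nat.DivMod using (_mod_)
open import Data.Product.Base using (_×_; _,_; proj₁; proj₂; ∃-syntax; ∃₂)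
open import Data.Product.Properties using (≡-dec; ,-injectiveˡ)
open import Data.Sign.Base as Sign using (Sign)
import Data.Sign.Properties as Sign
open import Data.Sum.Base using (inj₁; inj₂; [_,_]′)
import Data.Vec.Base as Vec
import Data.Vec.Properties as Vec
open import Data.Vec.Base using (Vec)
open import Function.Base using (_∘_)
open import Level using (0ℓ)
open import Relation.Binary.Construct.Closure.Equivalence as Eq using (EqClosure)
open import Relation.Binary.Core using (Rel)
open import Relation.Binary.Definitions using (Decidable)
open import Relation.Binary.PropositionalEquality using (_≡_; refl; sym; trans; cong; isEquivalence; setoid; module ≡-Reasoning)
open import Relation.Nullary using (Dec; yes; no; ¬_; ¬?; contradiction)
open import Relation.Nullary.Decidable using (map′)

module _ {N : ℕ} where

  relabel : (c d e : Fin N) → Fin N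
  relabel c d e with e ≟ᶠ d
  ... | yes _ = c
  ... | no  _ = e

  merge : Fin N × Fin N → Vec (Fin N) N → Vec (Fin N) N
  merge (x , y) v = Vec.map (relabel (Vec.lookup v x) (Vec.lookup v y)) v

  -- Two elements carry the same label iff the given pairs generate
  -- their equivalence.
  labels : List (Fin N × Fin N) → Vec (Fin N) N
  labels = foldr merge (Vec.allFin N)

  label : List (Fin N × Fin N) → Fin N → Fin N
  label ps = Vec.lookup (labels ps)

  Listed : List (Fin N × Fin N) → Rel (Fin N) 0ℓ
  Listed ps x y = (x , y) ∈ ps

  private
    label-∷ : ∀ a b ps x →
      label ((a , b) ∷ ps) x ≡ relabel (label ps a) (label ps b) (label ps x)
    label-∷ a b ps x = Vec.lookup-map x _ (labels ps)

    relabel-target : (c d : Fin N) → relabel c d d ≡ c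
    relabel-target c d with d ≟ᶠ d
    ... | yes _  = refl
    ... | no d≢d = contradiction refl d≢d

    relabel-source : (c d : Fin N) → relabel c d c ≡ c
    relabel-source c d with c ≟ᶠ d
    ... | yes _ = refl
    ... | no  _ = refl

    sound : ∀ ps x y → label ps x ≡ label ps y → EqClosure (Listed ps) x y
    sound [] x y eq
      with refl ← trans (sym (Vec.lookup-allFin x)) (trans eq (Vec.lookup-allFin y))
      = Eq.reflexive _
    sound ((a , b) ∷ ps) x y eq = go (trans (sym (label-∷ a b ps x)) (trans eq (label-∷ a b ps y)))
      where
      R = Listed ((a , b) ∷ ps)

      lift : ∀ u v → label ps u ≡ label ps v → EqClosure R u v
      lift u v = Eq.map there ∘ sound ps u v

      a∼b : EqClosure R a b
      a∼b = Eq.return (here refl)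

      go : relabel (label ps a) (label ps b) (label ps x) ≡
           relabel (label ps a) (label ps b) (label ps y) → EqClosure R x y
      go e with label ps x ≟ᶠ label ps b | label ps y ≟ᶠ label ps b
      ... | yes p | yes q = lift x y (trans p (sym q))
      ... | yes p | no  _ = Eq.transitive R (lift x b p)
                              (Eq.transitive R (Eq.symmetric R a∼b) (lift a y e))
      ... | no  _ | yes q = Eq.transitive R (lift x a e)
                              (Eq.transitive R a∼b (lift b y (sym q)))
      ... | no  _ | no  _ = lift x y e

    listed : ∀ ps {x y} → Listed ps x y → label ps x ≡ label ps y
    listed ((a , b) ∷ ps) (here refl) = begin
      label ((a , b) ∷ ps) a                               ≡⟨ label-∷ a b ps a ⟩
      relabel (label ps a) (label ps b) (label ps a)       ≡⟨ relabel-source _ _ ⟩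
      label ps a                                           ≡⟨ relabel-target _ (label ps b) ⟨
      relabel (label ps a) (label ps b) (label ps b)       ≡⟨ label-∷ a b ps b ⟨
      label ((a , b) ∷ ps) b                               ∎
      where open ≡-Reasoning
    listed ((a , b) ∷ ps) {x} {y} (there p) =
      trans (label-∷ a b ps x) (trans (cong (relabel _ _) (listed ps p)) (sym (label-∷ a b ps y)))

  eqClosure? : ∀ {R : Rel (Fin N) 0ℓ} → Decidable R → Decidable (EqClosure R)
  eqClosure? {R} R? x y =
    map′ (Eq.map from ∘ sound ps x y) (Eq.gfold isEquivalence (label ps) (listed ps ∘ to))
         (label ps x ≟ᶠ label ps y)
    where
    holds? = λ (p : Fin N × Fin N) → R? (proj₁ p) (proj₂ p)

    ps : List (Fin N × Fin N)
    ps = filter holds? (cartesianProduct (allFin N) (allFin N))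

    from : ∀ {u v} → Listed ps u v → R u v
    from = proj₂ ∘ ∈-filter⁻ holds? {xs = cartesianProduct (allFin N) (allFin N)}

    to : ∀ {u v} → R u v → Listed ps u v
    to {u} {v} = ∈-filter⁺ holds? (∈-cartesianProduct⁺ (∈-allFin u) (∈-allFin v))

-- The letters a₁, …, aₙ are indexed by Fin n; a letter is used with a
-- sign, Sign.- marking the inverse a_k⁻.
SignedLetter : ℕ → Set
SignedLetter n = Fin n × Sign

infix 9 _⁻
_⁻ : ∀ {n} → SignedLetter n → SignedLetter n
(k , s) ⁻ = k , Sign.opposite s

_≟ˡ_ : ∀ {n} → Decidable {A = SignedLetter n} _≡_
_≟ˡ_ = ≡-dec _≟ᶠ_ Sign._≟_

-- The word is read cyclically.  Every occurring letter appears exactly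
-- once with each sign.
record Surface (n : ℕ) : Set where
  field
    word   : List (SignedLetter n)
    unique : Unique word
    paired : ∀ {ℓ} → ℓ ∈ word → ℓ ⁻ ∈ word

next : ∀ {N} → Fin N → Fin N
next {suc N} i = suc (toℕ i) mod suc N

module _ {n : ℕ} (S : Surface n) where
  open Surface S

  sides : ℕ
  sides = length word

  -- Side i of the polygon runs from corner i to corner next i.  When side
  -- j carries the inverse of the letter on side i, they are identified
  -- with reversed orientation: corner i is glued to corner next j (and,
  -- exchanging i and j, corner next i to corner j).
  Glued : Rel (Fin sides) 0ℓ
  Glued x y = ∃[ j ] (lookup word j ≡ lookup word x ⁻ × y ≡ next j)

  glued? : Decidable Glued
  glued? x y = any? λ j → glue? j
    where
    glue? : ∀ j → Dec (lookup word j ≡ lookup word x ⁻ × y ≡ next j)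
    glue? j with lookup word j ≟ˡ (lookup word x ⁻) | y ≟ᶠ next j
    ... | yes p | yes q = yes (p , q)
    ... | no ¬p | _     = no (¬p ∘ proj₁)
    ... | _     | no ¬q = no (¬q ∘ proj₂)

  SameVertex : Rel (Fin sides) 0ℓ
  SameVertex = EqClosure Glued

  sameVertex? : Decidable SameVertex
  sameVertex? = eqClosure? glued?

  vertices : ℕ
  vertices = length (deduplicate sameVertex? (allFin sides))

  edges : ℕ
  edges = ⌊ sides /2⌋

  -- The polygon is the only face.  The cell structure presupposes a
  -- nonempty word.
  eulerCharacteristic : ℤ
  eulerCharacteristic = + vertices ℤ.- + edges ℤ.+ + 1

  HasGenus : ℕ → Set
  HasGenus g = eulerCharacteristic ≡ + 2 ℤ.- + 2 ℤ.* + g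

  hasGenus? : ∀ g → Dec (HasGenus g)
  hasGenus? g = eulerCharacteristic ℤ.≟ _

module _ {n : ℕ} where

  a a⁻ : Fin n → SignedLetter n
  a  k = k , Sign.+
  a⁻ k = k , Sign.-

  increasing decreasing : List (Fin n)
  increasing = allFin n
  decreasing = reverse (allFin n)

  inSubset outSubset : Subset n → List (Fin n) → List (Fin n)
  inSubset  K = filter (_∈ˢ? K)
  outSubset K = filter (λ k → ¬? (k ∈ˢ? K))

  R₁ R₂ R₃ R₄ : Subset n → List (SignedLetter n)
  R₁ K = map a  (inSubset  K decreasing)
  R₂ K = map a  (outSubset K increasing)
  R₃ T = map a⁻ (inSubset  T decreasing)
  R₄ T = map a⁻ (outSubset T increasing)

  ladderWord : (K T : Subset n) → List (SignedLetter n)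
  ladderWord K T = R₁ K ++ R₃ T ++ R₂ K ++ R₄ T

  private
    ∈-R : ∀ {x} {s t : Sign} {xs : List (Fin n)} → (x , s) ∈ map (_, t) xs → x ∈ xs
    ∈-R p with ∈-map⁻ (_, _) p
    ... | _ , q , refl = q

    sign-R : ∀ {x} {s t : Sign} {xs : List (Fin n)} → (x , s) ∈ map (_, t) xs → s ≡ t
    sign-R p with ∈-map⁻ (_, _) p
    ... | _ , _ , refl = refl

    signsDisjoint : ∀ (xs ys : List (Fin n)) {s t : Sign} → ¬ s ≡ t →
                    Disjoint (map (_, s) xs) (map (_, t) ys)
    signsDisjoint _ _ s≢t (p , q) = s≢t (trans (sym (sign-R p)) (sign-R q))

    subsetDisjoint : ∀ K (xs ys : List (Fin n)) {s : Sign} →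
                     Disjoint (map (_, s) (inSubset K xs)) (map (_, s) (outSubset K ys))
    subsetDisjoint K xs ys (p , q) =
      proj₂ (∈-filter⁻ (λ k → ¬? (k ∈ˢ? K)) {xs = ys} (∈-R q))
            (proj₂ (∈-filter⁻ (_∈ˢ? K) {xs = xs} (∈-R p)))

    ++-disjoint : ∀ {A : Set} (xs ys zs : List A) →
                  Disjoint xs ys → Disjoint xs zs → Disjoint xs (ys ++ zs)
    ++-disjoint _ ys _ d e (p , q) = [ (λ r → d (p , r)) , (λ r → e (p , r)) ]′ (∈-++⁻ ys q)

    decreasing-unique : Unique decreasing
    decreasing-unique =
      Permutation.Unique-resp-↭ (setoid (Fin n)) (↭⇒↭ₛ (↭-sym (↭-reverse (allFin n)))) (Unique.allFin⁺ n)

    R-unique : ∀ {xs : List (Fin n)} {s : Sign} → Unique xs → Unique (map (_, s) xs)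
    R-unique = Unique.map⁺ ,-injectiveˡ

    in-unique : ∀ K {xs : List (Fin n)} {s : Sign} → Unique xs → Unique (map (_, s) (inSubset K xs))
    in-unique K = R-unique ∘ Unique.filter⁺ (_∈ˢ? K)

    out-unique : ∀ K {xs : List (Fin n)} {s : Sign} → Unique xs → Unique (map (_, s) (outSubset K xs))
    out-unique K = R-unique ∘ Unique.filter⁺ (λ k → ¬? (k ∈ˢ? K))

  ladder-unique : ∀ K T → Unique (ladderWord K T)
  ladder-unique K T =
    Unique.++⁺ (in-unique K decreasing-unique)
      (Unique.++⁺ (in-unique T decreasing-unique)
        (Unique.++⁺ (out-unique K (Unique.allFin⁺ n)) (out-unique T (Unique.allFin⁺ n))
          (signsDisjoint K⁺ T⁺ λ ()))
        (++-disjoint (R₃ T) (R₂ K) (R₄ T)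
          (signsDisjoint T⁻ K⁺ λ ())
          (subsetDisjoint T decreasing increasing)))
      (++-disjoint (R₁ K) (R₃ T) (R₂ K ++ R₄ T)
        (signsDisjoint K⁻ T⁻ λ ())
        (++-disjoint (R₁ K) (R₂ K) (R₄ T)
          (subsetDisjoint K decreasing increasing)
          (signsDisjoint K⁻ T⁺ λ ())))
    where
    K⁻ = inSubset  K decreasing
    K⁺ = outSubset K increasing
    T⁻ = inSubset  T decreasing
    T⁺ = outSubset T increasing

  ladder-all : ∀ K T ℓ → ℓ ∈ ladderWord K T
  ladder-all K T (k , Sign.+) with k ∈ˢ? K
  ... | yes p = ∈-++⁺ˡ (∈-map⁺ a (∈-filter⁺ (_∈ˢ? K) (Any.reverse⁺ (∈-allFin k)) p))
  ... | no ¬p = ∈-++⁺ʳ (R₁ K) (∈-++⁺ʳ (R₃ T) (∈-++⁺ˡ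
                  (∈-map⁺ a (∈-filter⁺ (λ j → ¬? (j ∈ˢ? K)) (∈-allFin k) ¬p))))
  ladder-all K T (k , Sign.-) with k ∈ˢ? T
  ... | yes p = ∈-++⁺ʳ (R₁ K) (∈-++⁺ˡ (∈-map⁺ a⁻ (∈-filter⁺ (_∈ˢ? T) (Any.reverse⁺ (∈-allFin k)) p)))
  ... | no ¬p = ∈-++⁺ʳ (R₁ K) (∈-++⁺ʳ (R₃ T) (∈-++⁺ʳ (R₂ K)
                  (∈-map⁺ a⁻ (∈-filter⁺ (λ j → ¬? (j ∈ˢ? T)) (∈-allFin k) ¬p))))

  ladder : (K T : Subset n) → Surface n
  ladder K T = record
    { word   = ladderWord K T
    ; unique = ladder-unique K T
    ; paired = λ {ℓ} _ → ladder-all K T (ℓ ⁻)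
    }

subsets : ∀ n → List (Subset n)
subsets zero    = Vec.[] ∷ []
subsets (suc n) = map (outside Vec.∷_) (subsets n) ++ map (inside Vec.∷_) (subsets n)

𝒮₃ : ∀ n → List (Surface n)
𝒮₃ n = cartesianProductWith ladder (subsets n) (subsets n)

g₃ : (n i : ℕ) → ℕ
g₃ n i = length (filter (λ S → hasGenus? S i) (𝒮₃ n))

IsMinGenus IsMaxGenus : ∀ {n} → List (Surface n) → ℕ → Set
IsMinGenus 𝒮 q = Any (λ S → HasGenus S q) 𝒮 × All (λ S → ∀ i → HasGenus S i → q ≤ i) 𝒮
IsMaxGenus 𝒮 r = Any (λ S → HasGenus S r) 𝒮 × All (λ S → ∀ i → HasGenus S i → i ≤ r) 𝒮

-- c_q ≤ ⋯ ≤ c_{l-1} < c_l = ⋯ = c_m > c_{m+1} ≥ ⋯ ≥ c_r; the strict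
-- inequalities are void when l = q, respectively m = r.
record UnimodalWithModes (c : ℕ → ℕ) (q r l m : ℕ) : Set where
  field
    q≤l      : q ≤ l
    l≤m      : l ≤ m
    m≤r      : m ≤ r
    ascent   : ∀ i → q ≤ i → suc i < l → c i ≤ c (suc i)
    rise     : ∀ i → q ≤ i → suc i ≡ l → c i < c l
    plateau  : ∀ i → l ≤ i → i < m → c i ≡ c (suc i)
    fall     : m < r → c (suc m) < c m
    descent  : ∀ i → m < i → i < r → c (suc i) ≤ c i

Unimodal : (c : ℕ → ℕ) (q r : ℕ) → Set
Unimodal c q r = ∃₂ λ l m → UnimodalWithModes c q r l m

IsPeak : (c : ℕ → ℕ) (q r p : ℕ) → Set
IsPeak c q r p = UnimodalWithModes c q r p p

p₃ : ℕ → ℕ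
p₃ n = if n ≤ᵇ 6 then (n ∸ 1) / 2
       else if n ≡ᵇ 7 then 2
       else (n + 2) / 3

-- Cut the cyclic word R₁R₃R₂R₄ at the marks q, m, s between R₁|R₃, R₃|R₂ and
-- R₂|R₄.  The corners of the polygon then form closed vertices and three arcs
-- leading from mark to mark, hence a permutation of the marks.  Passing from n
-- to n + 1 letters, the inserted pair a, a⁻ either exchanges two ends of arcs,
-- or two starts, or joins an arc to another one or to itself; so the genus is
-- computed by an automaton on six states.
--
-- Solving the linear recurrence of the automaton gives, for i ≥ 1, s = n - 2i
-- and L-numbers ℓ(t,i) = C(t+i,i) + C(t+i-1,i),
--   4 gᵢ(n) = 8ⁱ ((2ˢ⁺¹ - 1) ℓ(s+1,i) + 8 ℓ(s-1,i+1)).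
-- The ratio ℓ(s+1,i) : ℓ(s-1,i+1) is a rational function, so comparing gᵢ(n)
-- with gᵢ₊₁(n) amounts to comparing 2ˢ with polynomials: the sequence falls
-- when i ≥ s and rises when i < s, except at (n,i) = (1,0), (2,0), (4,1), (7,2).

module Submission where

open import Defs renaming (a to a⁺)
open import Algebra.Properties.AbelianGroup using (∙-cancelˡ)
open import Data.Bool.Base using (Bool; true; false; T; if_then_else_)
open import Data.Empty using (⊥-elim)
open import Data.Fin.Base using (Fin; zero; suc; fromℕ; inject₁)
open import Data.Fin.Properties using (toℕ-injective; toℕ-fromℕ; toℕ-inject₁; toℕ-fromℕ<; toℕ<n; +↔⊎; cantor-schröder-bernstein)
open import Data.Fin.Relation.Unary.Top using (view; ‵fromℕ; ‵inject₁)
open import Data.Fin.Subset using (Subset)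
open import Data.Fin.Subset.Properties using () renaming (_∈?_ to _∈ˢ?_)
open import Data.Integer.Base as ℤ using () renaming (+_ to int)
import Data.Integer.Properties as ℤ
import Data.Integer.Tactic.RingSolver as ℤSolver
open import Data.List.Base using (List; []; _∷_; _++_; map; filter; reverse; length; lookup; allFin; deduplicate; cartesianProductWith)
open import Data.List.Membership.Propositional using (_∈_)
open import Data.List.Membership.Propositional.Properties using (∈-allFin; ∈-lookup; ∈-cartesianProductWith⁻)
open import Data.List.Properties using (unfold-reverse; map-tabulate; reverse-map; filter-++; filter-none; map-++; ++-assoc; ++-identityʳ; length-++; length-map)
open import Data.List.Relation.Unary.All as All using (All; []; _∷_)
open import Data.List.Relation.Unary.All.Properties using (¬Any⇒All¬)
open import Data.List.Relation.Unary.AllPairs using (AllPairs; []; _∷_)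
open import Data.List.Relation.Unary.Any as Any using (Any; any?)
open import Data.List.Relation.Unary.Any.Properties using (lookup-index; deduplicate⁺)
open import Data.List.Relation.Unary.Unique.DecSetoid.Properties using (deduplicate-!)
open import Data.Nat.Base using (ℕ; zero; suc; _+_; _*_; _^_; _/_; _%_; _!; _≤_; _<_; z≤n; s≤s; _≡ᵇ_; _<ᵇ_; ⌊_/2⌋; NonZero; >-nonZero)
open import Data.Nat.DivMod using (n%n≡0; m<n⇒m%n≡m; m/n*n≤m; m≡m%n+[m/n]*n; m%n<n)
open import Data.Nat.Properties
open import Data.Nat.Tactic.RingSolver using (solve-∀)
open import Data.Product.Base using (_×_; _,_; proj₁; proj₂; ∃-syntax; Σ-syntax; ∃₂)
open import Data.Sign.Base as Sign using (Sign)
open import Data.Sum.Base using (_⊎_; inj₁; inj₂; map₂)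
open import Data.Vec.Base using ([]; _∷_)
open import Function.Base using (_∘_; id)
open import Function.Bundles using (Inverse; _↔_)
open import Function.Properties.Inverse using (↔-sym)
open import Relation.Binary.Bundles using (DecSetoid)
import Relation.Binary.Construct.Closure.Equivalence as Eq
open import Relation.Binary.Definitions using (Symmetric; Decidable)
open import Relation.Binary.PropositionalEquality using (_≡_; _≢_; refl; sym; trans; cong; cong₂; subst; subst₂; isEquivalence; module ≡-Reasoning)
open import Relation.Binary.Structures using (IsEquivalence)
open import Relation.Nullary using (Dec; yes; no; does; ¬_; ¬?)
open import Relation.Nullary.Decidable using (dec-true; dec-false)
import Relation.Unary as Unary

-- The obstacle is that `vertices` deduplicates a list along an equivalence closure, and neither
-- operation follows the insertion of a letter. The vertices are therefore given by a universal
-- property: they are the initial set of labels for which the boundary word is a closed walk.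
-- Initiality survives an insertion because the new sides meet the old word only at the marks, so
-- each of the 24 combinations of state and insertion is checked on three marks, whatever the word.
-- The counts become solvable because the states `smq` and `msq` are left by no step, and because
-- the counts from `qms` and `sqm` have equal increments once the genus is shifted by one. The -1 in
-- the closed form is a subtraction; all identities are stated with such terms moved to the other
-- side.

-- Corner labels as walks along the word

module _ {n : ℕ} {D : Set} (u : SignedLetter n → D) where

  -- The states of a walk are corners. Side `ℓ` starts at a corner labelled `u ℓ`; its gluing to
  -- `ℓ ⁻` with reversed orientation identifies its final corner with the initial corner of `ℓ ⁻`,
  -- whence `u (ℓ ⁻)`.
  Walk : D → List (SignedLetter n) → D → Set
  Walk c []      d = c ≡ d
  Walk c (ℓ ∷ w) d = c ≡ u ℓ × Walk (u (ℓ ⁻)) w d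

  walk-++ : ∀ xs {ys c d e} → Walk c xs d → Walk d ys e → Walk c (xs ++ ys) e
  walk-++ []       refl    r′ = r′
  walk-++ (_ ∷ xs) (r , p) r′ = r , walk-++ xs p r′

  walk-split : ∀ xs {ys c e} → Walk c (xs ++ ys) e → ∃[ d ] Walk c xs d × Walk d ys e
  walk-split []       p       = _ , refl , p
  walk-split (_ ∷ xs) (r , p) with walk-split xs p
  ... | d , r′ , p′ = d , (r , r′) , p′

walk-map : ∀ {n} {C D : Set} {v : SignedLetter n → C} {u : SignedLetter n → D} (h : C → D) →
           (∀ ℓ → h (v ℓ) ≡ u ℓ) → ∀ w {c d} → Walk v c w d → Walk u (h c) w (h d)
walk-map h hv []      refl       = refl
walk-map h hv (ℓ ∷ w) (refl , p) =
  hv ℓ , subst (λ x → Walk _ x w _) (hv (ℓ ⁻)) (walk-map h hv w p)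

lift : ∀ {n} → SignedLetter n → SignedLetter (suc n)
lift (k , t) = suc k , t

module _ {n : ℕ} {D : Set} {u : SignedLetter (suc n) → D} where

  walk-lift⁺ : ∀ w {c d} → Walk (u ∘ lift) c w d → Walk u c (map lift w) d
  walk-lift⁺ []            p       = p
  walk-lift⁺ ((_ , _) ∷ w) (r , p) = r , walk-lift⁺ w p

  walk-lift⁻ : ∀ w {c d} → Walk u c (map lift w) d → Walk (u ∘ lift) c w d
  walk-lift⁻ []            p       = p
  walk-lift⁻ ((_ , _) ∷ w) (r , p) = r , walk-lift⁻ w p

-- The word cut at three marks

data Mark : Set where
  qᵐ mᵐ sᵐ : Mark

record Segments (n : ℕ) : Set where
  constructor segments
  field
    r₁ r₃ r₂ r₄ : List (SignedLetter n)

open Segments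

-- The cyclic word r₁ qᵐ r₃ mᵐ r₂ sᵐ r₄, read with a jump at each mark.
record Walks {n} (S : Segments n) {D : Set} (u : SignedLetter n → D) (P : D) (start end : Mark → D) : Set where
  constructor walks
  field
    w₁ : Walk u P         (r₁ S) (end qᵐ)
    w₃ : Walk u (start qᵐ) (r₃ S) (end mᵐ)
    w₂ : Walk u (start mᵐ) (r₂ S) (end sᵐ)
    w₄ : Walk u (start sᵐ) (r₄ S) P

-- cyc j is a vertex that no longer meets a mark; arc x is the sequence of
-- corners met when turning about a vertex from the far side of the mark x
-- until a mark is met again.
Label : ℕ → Set
Label k = Fin k ⊎ Mark

pattern cyc j = inj₁ j
pattern arc x = inj₂ x

-- The new letter has the smallest index, so both of its occurrences are
-- adjacent to marks.
insert : ∀ {n} (b c : Bool) → Segments n → Segments (suc n)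
insert true  true  (segments r₁ r₃ r₂ r₄) =
  segments (map lift r₁ ++ a⁺ zero ∷ []) (map lift r₃ ++ a⁻ zero ∷ []) (map lift r₂) (map lift r₄)
insert true  false (segments r₁ r₃ r₂ r₄) =
  segments (map lift r₁ ++ a⁺ zero ∷ []) (map lift r₃) (map lift r₂) (a⁻ zero ∷ map lift r₄)
insert false true  (segments r₁ r₃ r₂ r₄) =
  segments (map lift r₁) (map lift r₃ ++ a⁻ zero ∷ []) (a⁺ zero ∷ map lift r₂) (map lift r₄)
insert false false (segments r₁ r₃ r₂ r₄) =
  segments (map lift r₁) (map lift r₃) (a⁺ zero ∷ map lift r₂) (a⁻ zero ∷ map lift r₄)

extend : ∀ {n} {D : Set} → D → D → (SignedLetter n → D) → SignedLetter (suc n) → D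
extend x y v (zero , Sign.+) = x
extend x y v (zero , Sign.-) = y
extend x y v (suc k , t)     = v (k , t)

module _ {D : Set} (x y : D) where

  -- Here `x` and `y` label the initial corners of the new sides a and a⁻. A new side stands between
  -- an old segment and a mark: the inner functions give the boundary labels seen by the old
  -- segments, and `Seam` the equations that the other ends of the new sides impose at the marks.
  innerStart innerEnd : (b c : Bool) → (Mark → D) → Mark → D
  innerStart true  true  f = f
  innerStart true  false f = λ { qᵐ → f qᵐ ; mᵐ → f mᵐ ; sᵐ → x }
  innerStart false true  f = λ { qᵐ → f qᵐ ; mᵐ → y ; sᵐ → f sᵐ }
  innerStart false false f = λ { qᵐ → f qᵐ ; mᵐ → y ; sᵐ → x }
  innerEnd true  true  f = λ { qᵐ → x ; mᵐ → y ; sᵐ → f sᵐ }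
  innerEnd true  false f = λ { qᵐ → x ; mᵐ → f mᵐ ; sᵐ → f sᵐ }
  innerEnd false true  f = λ { qᵐ → f qᵐ ; mᵐ → y ; sᵐ → f sᵐ }
  innerEnd false false f = f

  Seam : (b c : Bool) (start end : Mark → D) → Set
  Seam true  true  start end = end qᵐ ≡ y × end mᵐ ≡ x
  Seam true  false start end = end qᵐ ≡ y × start sᵐ ≡ y
  Seam false true  start end = end mᵐ ≡ x × start mᵐ ≡ x
  Seam false false start end = start mᵐ ≡ x × start sᵐ ≡ y

module _ {n} {D : Set} {S : Segments n} {u : SignedLetter (suc n) → D} {P : D} {start end : Mark → D} where
  private
    x = u (a⁺ zero)
    y = u (a⁻ zero)

  walks-insert⁻ : ∀ b c → Walks (insert b c S) u P start end →
                  Seam x y b c start end × Walks S (u ∘ lift) P (innerStart x y b c start) (innerEnd x y b c end)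
  walks-insert⁻ true  true  (walks w₁ w₃ w₂ w₄)
    with _ , w₁′ , refl , e₁ ← walk-split u (map lift (r₁ S)) w₁
       | _ , w₃′ , refl , e₃ ← walk-split u (map lift (r₃ S)) w₃
    = (sym e₁ , sym e₃) , walks (walk-lift⁻ (r₁ S) w₁′) (walk-lift⁻ (r₃ S) w₃′) (walk-lift⁻ (r₂ S) w₂) (walk-lift⁻ (r₄ S) w₄)
  walks-insert⁻ true  false (walks w₁ w₃ w₂ (e₄ , w₄))
    with _ , w₁′ , refl , e₁ ← walk-split u (map lift (r₁ S)) w₁
    = (sym e₁ , e₄) , walks (walk-lift⁻ (r₁ S) w₁′) (walk-lift⁻ (r₃ S) w₃) (walk-lift⁻ (r₂ S) w₂) (walk-lift⁻ (r₄ S) w₄)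
  walks-insert⁻ false true  (walks w₁ w₃ (e₂ , w₂) w₄)
    with _ , w₃′ , refl , e₃ ← walk-split u (map lift (r₃ S)) w₃
    = (sym e₃ , e₂) , walks (walk-lift⁻ (r₁ S) w₁) (walk-lift⁻ (r₃ S) w₃′) (walk-lift⁻ (r₂ S) w₂) (walk-lift⁻ (r₄ S) w₄)
  walks-insert⁻ false false (walks w₁ w₃ (e₂ , w₂) (e₄ , w₄)) =
    (e₂ , e₄) , walks (walk-lift⁻ (r₁ S) w₁) (walk-lift⁻ (r₃ S) w₃) (walk-lift⁻ (r₂ S) w₂) (walk-lift⁻ (r₄ S) w₄)

  walks-insert⁺ : ∀ b c → Seam x y b c start end →
                  Walks S (u ∘ lift) P (innerStart x y b c start) (innerEnd x y b c end) →
                  Walks (insert b c S) u P start end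
  walks-insert⁺ true  true  (e₁ , e₃) (walks w₁ w₃ w₂ w₄) =
    walks (walk-++ u (map lift (r₁ S)) (walk-lift⁺ (r₁ S) w₁) (refl , sym e₁))
          (walk-++ u (map lift (r₃ S)) (walk-lift⁺ (r₃ S) w₃) (refl , sym e₃))
          (walk-lift⁺ (r₂ S) w₂) (walk-lift⁺ (r₄ S) w₄)
  walks-insert⁺ true  false (e₁ , e₄) (walks w₁ w₃ w₂ w₄) =
    walks (walk-++ u (map lift (r₁ S)) (walk-lift⁺ (r₁ S) w₁) (refl , sym e₁))
          (walk-lift⁺ (r₃ S) w₃) (walk-lift⁺ (r₂ S) w₂) (e₄ , walk-lift⁺ (r₄ S) w₄)
  walks-insert⁺ false true  (e₃ , e₂) (walks w₁ w₃ w₂ w₄) =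
    walks (walk-lift⁺ (r₁ S) w₁)
          (walk-++ u (map lift (r₃ S)) (walk-lift⁺ (r₃ S) w₃) (refl , sym e₃))
          (e₂ , walk-lift⁺ (r₂ S) w₂) (walk-lift⁺ (r₄ S) w₄)
  walks-insert⁺ false false (e₂ , e₄) (walks w₁ w₃ w₂ w₄) =
    walks (walk-lift⁺ (r₁ S) w₁) (walk-lift⁺ (r₃ S) w₃)
          (e₂ , walk-lift⁺ (r₂ S) w₂) (e₄ , walk-lift⁺ (r₄ S) w₄)

walks-map : ∀ {n} {S : Segments n} {C D : Set} {v : SignedLetter n → C} {u : SignedLetter n → D} {P}
            {start end : Mark → C} {start′ end′ : Mark → D} (h : C → D) →
            (∀ ℓ → h (v ℓ) ≡ u ℓ) → (∀ x → h (start x) ≡ start′ x) → (∀ x → h (end x) ≡ end′ x) →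
            Walks S v P start end → Walks S u (h P) start′ end′
walks-map {S = S} h hv hs he (walks w₁ w₃ w₂ w₄) = walks
  (subst (Walk _ _ _) (he qᵐ) (walk-map h hv (r₁ S) w₁))
  (subst (λ z → Walk _ z _ _) (hs qᵐ) (subst (Walk _ _ _) (he mᵐ) (walk-map h hv (r₃ S) w₃)))
  (subst (λ z → Walk _ z _ _) (hs mᵐ) (subst (Walk _ _ _) (he sᵐ) (walk-map h hv (r₂ S) w₂)))
  (subst (λ z → Walk _ z _ _) (hs sᵐ) (walk-map h hv (r₄ S) w₄))

record Fits {k} (π : Mark → Mark) {D : Set} (start end : Mark → D) (g : Label k → D) : Set where
  constructor fits
  field
    onStart : ∀ x → g (arc x) ≡ start x
    onEnd   : ∀ x → g (arc (π x)) ≡ end x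

open Fits

-- The values of `start` and `end` at a mark are kept independent, which leaves room for inserting a
-- letter there later. The map `g` is determined: by `onto` on closed vertices, by `onStart` on
-- arcs.
record Labelling {n} (S : Segments n) (k : ℕ) (π : Mark → Mark) : Set₁ where
  field
    v       : SignedLetter n → Label k
    P       : Label k
    closed  : Walks S v P inj₂ (inj₂ ∘ π)
    onto    : ∀ j → ∃[ ℓ ] v ℓ ≡ cyc j
    initial : ∀ {D : Set} {u : SignedLetter n → D} {P′ start end} → Walks S u P′ start end →
              ∃[ g ] (∀ ℓ → g (v ℓ) ≡ u ℓ) × Fits π start end g

-- The part of an insertion that does not mention the word: the labels `x`, `y` of the new sides are
-- adjoined freely to the old labels, subject to `Seam` and to the inner boundary values.
record Pushout (b c : Bool) {k k′} (π π′ : Mark → Mark) : Set₁ where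
  field
    h       : Label k → Label k′
    x y     : Label k′
    seam    : Seam x y b c inj₂ (inj₂ ∘ π′)
    fit     : Fits π (innerStart x y b c inj₂) (innerEnd x y b c (inj₂ ∘ π′)) h
    onto    : ∀ j → (∃[ i ] h (cyc i) ≡ cyc j) ⊎ (x ≡ cyc j ⊎ y ≡ cyc j)
    initial : ∀ {D : Set} {x′ y′ : D} {start end} {g : Label k → D} → Seam x′ y′ b c start end →
              Fits π (innerStart x′ y′ b c start) (innerEnd x′ y′ b c end) g →
              ∃[ g′ ] (∀ z → g′ (h z) ≡ g z) × g′ x ≡ x′ × g′ y ≡ y′ × Fits π′ start end g′

labelling-insert : ∀ {n} {S : Segments n} {b c k k′ π π′} → Pushout b c {k} {k′} π π′ →
                   Labelling S k π → Labelling (insert b c S) k′ π′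
labelling-insert {n} {S} {b} {c} {k} {k′} {π} {π′} pushout L = record
  { v       = v′
  ; P       = O.h L.P
  ; closed  = walks-insert⁺ b c O.seam (walks-map O.h (λ { (_ , _) → refl }) (onStart O.fit) (onEnd O.fit) L.closed)
  ; onto    = onto
  ; initial = initial
  }
  where
  module O = Pushout pushout
  module L = Labelling L
  v′ = extend O.x O.y (O.h ∘ L.v)

  onto : ∀ j → ∃[ ℓ ] v′ ℓ ≡ cyc j
  onto j with O.onto j
  ... | inj₁ (i , hi) with (l , t) , vℓ ← L.onto i = (suc l , t) , trans (cong O.h vℓ) hi
  ... | inj₂ (inj₁ p) = a⁺ zero , p
  ... | inj₂ (inj₂ p) = a⁻ zero , p

  initial : ∀ {D : Set} {u : SignedLetter (suc n) → D} {P′ start end} → Walks (insert b c S) u P′ start end →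
            ∃[ g ] (∀ ℓ → g (v′ ℓ) ≡ u ℓ) × Fits π′ start end g
  initial {u = u} w
    with seam , w′ ← walks-insert⁻ b c w
    with g , gv , fit ← L.initial w′
    with g′ , g′h , g′x , g′y , fit′ ← O.initial seam fit
    = g′ , (λ { (zero , Sign.+) → g′x ; (zero , Sign.-) → g′y ; (suc l , t) → trans (g′h _) (gv (l , t)) }) , fit′

-- The four kinds of insertion

-- Both new sides stand just before a mark. The arc that ended at `qᵐ` is continued across the
-- gluing of a with a⁻ and now ends at `mᵐ`, and conversely; no label appears or disappears.
swapEnds : ∀ {k π π′} → π′ qᵐ ≡ π mᵐ → π′ mᵐ ≡ π qᵐ → π′ sᵐ ≡ π sᵐ → Pushout true true {k} {k} π π′
swapEnds {k} {π} {π′} eq em es = record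
  { h       = id
  ; x       = arc (π qᵐ)
  ; y       = arc (π mᵐ)
  ; seam    = cong inj₂ eq , cong inj₂ em
  ; fit     = fits (λ _ → refl) (λ { qᵐ → refl ; mᵐ → refl ; sᵐ → cong inj₂ (sym es) })
  ; onto    = λ j → inj₁ (j , refl)
  ; initial = λ { {g = g} (e₁ , e₃) f → g , (λ _ → refl) , onEnd f qᵐ , onEnd f mᵐ , fits (onStart f)
      (λ { qᵐ → trans (cong (g ∘ inj₂) eq) (trans (onEnd f mᵐ) (sym e₁))
         ; mᵐ → trans (cong (g ∘ inj₂) em) (trans (onEnd f qᵐ) (sym e₃))
         ; sᵐ → trans (cong (g ∘ inj₂) es) (onEnd f sᵐ) }) }
  }

exchange : Mark → Mark
exchange qᵐ = qᵐ
exchange mᵐ = sᵐ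
exchange sᵐ = mᵐ

-- Both new sides stand just after a mark, so two starts are exchanged. Since arcs are named by
-- their starts, here the labels themselves are renamed by `h`.
swapStarts : ∀ {k π π′} → (∀ x → π′ x ≡ exchange (π x)) → Pushout false false {k} {k} π π′
swapStarts {k} {π} {π′} eq = record
  { h       = h
  ; x       = arc mᵐ
  ; y       = arc sᵐ
  ; seam    = refl , refl
  ; fit     = fits (λ { qᵐ → refl ; mᵐ → refl ; sᵐ → refl }) (λ x → cong inj₂ (sym (eq x)))
  ; onto    = λ j → inj₁ (j , refl)
  ; initial = λ { {g = g} (e₂ , e₄) f → g ∘ h
                , (λ { (cyc i) → refl ; (arc qᵐ) → refl ; (arc mᵐ) → refl ; (arc sᵐ) → refl })
                , onStart f sᵐ , onStart f mᵐ
                , fits (λ { qᵐ → onStart f qᵐ ; mᵐ → trans (onStart f sᵐ) (sym e₂) ; sᵐ → trans (onStart f mᵐ) (sym e₄) })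
                       (λ x → trans (cong (g ∘ h ∘ inj₂) (eq x)) (trans (cong g (h-exchange (π x))) (onEnd f x))) }
  }
  where
  h : Label k → Label k
  h (cyc i) = cyc i
  h (arc x) = arc (exchange x)

  h-exchange : ∀ z → arc (exchange (exchange z)) ≡ arc z
  h-exchange qᵐ = refl
  h-exchange mᵐ = refl
  h-exchange sᵐ = refl

_≟ᵐ_ : (x y : Mark) → Dec (x ≡ y)
qᵐ ≟ᵐ qᵐ = yes refl
qᵐ ≟ᵐ mᵐ = no λ ()
qᵐ ≟ᵐ sᵐ = no λ ()
mᵐ ≟ᵐ qᵐ = no λ ()
mᵐ ≟ᵐ mᵐ = yes refl
mᵐ ≟ᵐ sᵐ = no λ ()
sᵐ ≟ᵐ qᵐ = no λ ()
sᵐ ≟ᵐ mᵐ = no λ ()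
sᵐ ≟ᵐ sᵐ = yes refl

update : ∀ {D : Set} → Mark → D → (Mark → D) → Mark → D
update t d f x with x ≟ᵐ t
... | yes _ = d
... | no  _ = f x

update-≡ : ∀ {D : Set} t (d : D) f → update t d f t ≡ d
update-≡ t d f with t ≟ᵐ t
... | yes _ = refl
... | no ¬p = ⊥-elim (¬p refl)

update-≢ : ∀ {D : Set} {t x} (d : D) f → x ≢ t → update t d f x ≡ f x
update-≢ {t = t} {x} d f x≢t with x ≟ᵐ t
... | yes p = ⊥-elim (x≢t p)
... | no _  = refl

-- The arc ending at e is glued to the arc starting at t; a fresh arc then
-- leads from t to e.
record Join (e t : Mark) {k k′} (π π′ : Mark → Mark) : Set₁ where
  field
    h       : Label k → Label k′
    fresh   : π′ e ≡ t
    glued   : h (arc (π e)) ≡ h (arc t)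
    start-≢ : ∀ x → x ≢ t → h (arc x) ≡ arc x
    end-≢   : ∀ x → x ≢ e → h (arc (π x)) ≡ arc (π′ x)
    onto    : ∀ j → (∃[ i ] h (cyc i) ≡ cyc j) ⊎ h (arc t) ≡ cyc j
    initial : ∀ {D : Set} {g : Label k → D} → g (arc (π e)) ≡ g (arc t) → ∀ d →
              Σ[ g′ ∈ (Label k′ → D) ] (∀ z → g′ (h z) ≡ g z) × g′ (arc t) ≡ d

-- The merged arc keeps the start `π e` and takes over the end of the arc from `t`. This releases
-- the name `arc t` for the fresh arc, whose value `d` is free because no old label bears on it.
mergeArcs : ∀ {e t k π π′} → π e ≢ t → (∀ x → x ≢ e → π′ x ≡ update t (π e) id (π x)) → π′ e ≡ t →
        Join e t {k} {k} π π′
mergeArcs {e} {t} {k} {π} {π′} πe≢t eq fresh = record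
  { h       = h
  ; fresh   = fresh
  ; glued   = cong inj₂ (trans (update-≢ _ _ πe≢t) (sym (update-≡ t _ _)))
  ; start-≢ = λ x x≢t → cong inj₂ (update-≢ _ _ x≢t)
  ; end-≢   = λ x x≢e → cong inj₂ (sym (eq x x≢e))
  ; onto    = λ j → inj₁ (j , refl)
  ; initial = initial
  }
  where
  h : Label k → Label k
  h (cyc i) = cyc i
  h (arc x) = arc (update t (π e) id x)

  initial : ∀ {D : Set} {g : Label k → D} → g (arc (π e)) ≡ g (arc t) → ∀ d →
            Σ[ g′ ∈ (Label k → D) ] (∀ z → g′ (h z) ≡ g z) × g′ (arc t) ≡ d
  initial {D} {g} p d = g′ , g′h , update-≡ t d _
    where
    g′ : Label k → D
    g′ (cyc i) = g (cyc i)
    g′ (arc x) = update t d (g ∘ inj₂) x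
    g′h : ∀ z → g′ (h z) ≡ g z
    g′h (cyc i) = refl
    g′h (arc x) with x ≟ᵐ t
    ... | yes refl = trans (update-≢ d _ πe≢t) p
    ... | no x≢t   = update-≢ d _ x≢t

-- The arc ending at `e` is itself the arc from `t`, so the gluing completes a vertex, which becomes
-- `cyc zero`. The fresh arc takes the place of the old one and the permutation stays the same.
close : ∀ {e t k π} → π e ≡ t → (∀ x → x ≢ e → π x ≢ t) → Join e t {k} {suc k} π π
close {e} {t} {k} {π} πe≡t inj = record
  { h       = h
  ; fresh   = πe≡t
  ; glued   = cong (h ∘ inj₂) πe≡t
  ; start-≢ = λ x x≢t → update-≢ _ _ x≢t
  ; end-≢   = λ x x≢e → update-≢ _ _ (inj x x≢e)
  ; onto    = λ { zero → inj₂ (update-≡ t _ _) ; (suc i) → inj₁ (i , refl) }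
  ; initial = initial
  }
  where
  h : Label k → Label (suc k)
  h (cyc i) = cyc (suc i)
  h (arc x) = update t (cyc zero) inj₂ x

  initial : ∀ {D : Set} {g : Label k → D} → g (arc (π e)) ≡ g (arc t) → ∀ d →
            Σ[ g′ ∈ (Label (suc k) → D) ] (∀ z → g′ (h z) ≡ g z) × g′ (arc t) ≡ d
  initial {D} {g} p d = g′ , g′h , update-≡ t d _
    where
    g′ : Label (suc k) → D
    g′ (cyc zero)    = g (arc t)
    g′ (cyc (suc i)) = g (cyc i)
    g′ (arc x)       = update t d (g ∘ inj₂) x
    g′h : ∀ z → g′ (h z) ≡ g z
    g′h (cyc i) = refl
    g′h (arc x) with x ≟ᵐ t
    ... | yes refl = refl
    ... | no x≢t   = update-≢ d _ x≢t

-- With a at the end of r₁ and a⁻ at the start of r₄, the label `x` is both the old end at `qᵐ` and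
-- the old start at `sᵐ`, while `y` lies only on the fresh arc from `sᵐ` to `qᵐ`.
joinQS : ∀ {k k′ π π′} → Join qᵐ sᵐ {k} {k′} π π′ → Pushout true false {k} {k′} π π′
joinQS {π′ = π′} J = record
  { h       = h
  ; x       = h (arc sᵐ)
  ; y       = arc sᵐ
  ; seam    = cong inj₂ fresh , refl
  ; fit     = fits (λ { qᵐ → start-≢ qᵐ (λ ()) ; mᵐ → start-≢ mᵐ (λ ()) ; sᵐ → refl })
                   (λ { qᵐ → glued ; mᵐ → end-≢ mᵐ (λ ()) ; sᵐ → end-≢ sᵐ (λ ()) })
  ; onto    = λ j → map₂ inj₁ (onto j)
  ; initial = λ { {y′ = y′} {g = g} (e₁ , e₄) f →
      let g′ , g′h , g′t = initial {g = g} (trans (onEnd f qᵐ) (sym (onStart f sᵐ))) y′ in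
      g′ , g′h , trans (g′h (arc sᵐ)) (onStart f sᵐ) , g′t
      , fits (λ { qᵐ → trans (cong g′ (sym (start-≢ qᵐ λ ()))) (trans (g′h _) (onStart f qᵐ))
                ; mᵐ → trans (cong g′ (sym (start-≢ mᵐ λ ()))) (trans (g′h _) (onStart f mᵐ))
                ; sᵐ → trans g′t (sym e₄) })
             (λ { qᵐ → trans (cong (g′ ∘ inj₂) fresh) (trans g′t (sym e₁))
                ; mᵐ → trans (cong g′ (sym (end-≢ mᵐ λ ()))) (trans (g′h _) (onEnd f mᵐ))
                ; sᵐ → trans (cong g′ (sym (end-≢ sᵐ λ ()))) (trans (g′h _) (onEnd f sᵐ)) }) }
  }
  where open Join J

-- Across `mᵐ` the word now reads a⁻ a. The corner between the two sides is the fresh arc from `mᵐ`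
-- to itself. Such a cancelling pair leaves the genus unchanged, hence `gain false true` is 0 in
-- every state.
joinMM : ∀ {k k′ π π′} → Join mᵐ mᵐ {k} {k′} π π′ → Pushout false true {k} {k′} π π′
joinMM {π′ = π′} J = record
  { h       = h
  ; x       = arc mᵐ
  ; y       = h (arc mᵐ)
  ; seam    = cong inj₂ fresh , refl
  ; fit     = fits (λ { qᵐ → start-≢ qᵐ (λ ()) ; mᵐ → refl ; sᵐ → start-≢ sᵐ (λ ()) })
                   (λ { qᵐ → end-≢ qᵐ (λ ()) ; mᵐ → glued ; sᵐ → end-≢ sᵐ (λ ()) })
  ; onto    = λ j → map₂ inj₂ (onto j)
  ; initial = λ { {x′ = x′} {g = g} (e₃ , e₂) f →
      let g′ , g′h , g′t = initial {g = g} (trans (onEnd f mᵐ) (sym (onStart f mᵐ))) x′ in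
      g′ , g′h , g′t , trans (g′h (arc mᵐ)) (onStart f mᵐ)
      , fits (λ { qᵐ → trans (cong g′ (sym (start-≢ qᵐ λ ()))) (trans (g′h _) (onStart f qᵐ))
                ; mᵐ → trans g′t (sym e₂)
                ; sᵐ → trans (cong g′ (sym (start-≢ sᵐ λ ()))) (trans (g′h _) (onStart f sᵐ)) })
             (λ { qᵐ → trans (cong g′ (sym (end-≢ qᵐ λ ()))) (trans (g′h _) (onEnd f qᵐ))
                ; mᵐ → trans (cong (g′ ∘ inj₂) fresh) (trans g′t (sym e₃))
                ; sᵐ → trans (cong g′ (sym (end-≢ sᵐ λ ()))) (trans (g′h _) (onEnd f sᵐ)) }) }
  }
  where open Join J

-- The automaton

-- A permutation π of the marks, named by π q, π m, π s: the arc ending at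
-- x starts at π x.
data Arcs : Set where
  qms qsm mqs msq sqm smq : Arcs

⟦_⟧ : Arcs → Mark → Mark
⟦ qms ⟧ = λ { qᵐ → qᵐ ; mᵐ → mᵐ ; sᵐ → sᵐ }
⟦ qsm ⟧ = λ { qᵐ → qᵐ ; mᵐ → sᵐ ; sᵐ → mᵐ }
⟦ mqs ⟧ = λ { qᵐ → mᵐ ; mᵐ → qᵐ ; sᵐ → sᵐ }
⟦ msq ⟧ = λ { qᵐ → mᵐ ; mᵐ → sᵐ ; sᵐ → qᵐ }
⟦ sqm ⟧ = λ { qᵐ → sᵐ ; mᵐ → qᵐ ; sᵐ → mᵐ }
⟦ smq ⟧ = λ { qᵐ → sᵐ ; mᵐ → mᵐ ; sᵐ → qᵐ }

rearrange : (b c : Bool) → Arcs → Arcs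
rearrange true  true  qms = mqs
rearrange true  true  qsm = sqm
rearrange true  true  mqs = qms
rearrange true  true  msq = smq
rearrange true  true  sqm = qsm
rearrange true  true  smq = msq
rearrange false false qms = qsm
rearrange false false qsm = qms
rearrange false false mqs = sqm
rearrange false false msq = smq
rearrange false false sqm = mqs
rearrange false false smq = msq
rearrange true  false qms = smq
rearrange true  false qsm = sqm
rearrange true  false mqs = sqm
rearrange true  false msq = smq
rearrange true  false sqm = sqm
rearrange true  false smq = smq
rearrange false true  qms = qms
rearrange false true  qsm = qms
rearrange false true  mqs = qms
rearrange false true  msq = smq
rearrange false true  sqm = smq
rearrange false true  smq = smq

closing : (b c : Bool) → Arcs → ℕ
closing true  false sqm = 1
closing true  false smq = 1
closing false true  qms = 1
closing false true  smq = 1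
closing _     _     _   = 0

pushout : ∀ b c σ {k} → Pushout b c {k} {closing b c σ + k} ⟦ σ ⟧ ⟦ rearrange b c σ ⟧
pushout true  true  qms = swapEnds refl refl refl
pushout true  true  qsm = swapEnds refl refl refl
pushout true  true  mqs = swapEnds refl refl refl
pushout true  true  msq = swapEnds refl refl refl
pushout true  true  sqm = swapEnds refl refl refl
pushout true  true  smq = swapEnds refl refl refl
pushout false false qms = swapStarts λ { qᵐ → refl ; mᵐ → refl ; sᵐ → refl }
pushout false false qsm = swapStarts λ { qᵐ → refl ; mᵐ → refl ; sᵐ → refl }
pushout false false mqs = swapStarts λ { qᵐ → refl ; mᵐ → refl ; sᵐ → refl }
pushout false false msq = swapStarts λ { qᵐ → refl ; mᵐ → refl ; sᵐ → refl }
pushout false false sqm = swapStarts λ { qᵐ → refl ; mᵐ → refl ; sᵐ → refl }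
pushout false false smq = swapStarts λ { qᵐ → refl ; mᵐ → refl ; sᵐ → refl }
pushout true  false qms = joinQS (mergeArcs (λ ()) (λ { qᵐ x≢q → ⊥-elim (x≢q refl) ; mᵐ _ → refl ; sᵐ _ → refl }) refl)
pushout true  false qsm = joinQS (mergeArcs (λ ()) (λ { qᵐ x≢q → ⊥-elim (x≢q refl) ; mᵐ _ → refl ; sᵐ _ → refl }) refl)
pushout true  false mqs = joinQS (mergeArcs (λ ()) (λ { qᵐ x≢q → ⊥-elim (x≢q refl) ; mᵐ _ → refl ; sᵐ _ → refl }) refl)
pushout true  false msq = joinQS (mergeArcs (λ ()) (λ { qᵐ x≢q → ⊥-elim (x≢q refl) ; mᵐ _ → refl ; sᵐ _ → refl }) refl)
pushout true  false sqm = joinQS (close refl λ { qᵐ x≢q → ⊥-elim (x≢q refl) ; mᵐ _ () ; sᵐ _ () })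
pushout true  false smq = joinQS (close refl λ { qᵐ x≢q → ⊥-elim (x≢q refl) ; mᵐ _ () ; sᵐ _ () })
pushout false true  qms = joinMM (close refl λ { qᵐ _ () ; mᵐ x≢m → ⊥-elim (x≢m refl) ; sᵐ _ () })
pushout false true  qsm = joinMM (mergeArcs (λ ()) (λ { qᵐ _ → refl ; mᵐ x≢m → ⊥-elim (x≢m refl) ; sᵐ _ → refl }) refl)
pushout false true  mqs = joinMM (mergeArcs (λ ()) (λ { qᵐ _ → refl ; mᵐ x≢m → ⊥-elim (x≢m refl) ; sᵐ _ → refl }) refl)
pushout false true  msq = joinMM (mergeArcs (λ ()) (λ { qᵐ _ → refl ; mᵐ x≢m → ⊥-elim (x≢m refl) ; sᵐ _ → refl }) refl)
pushout false true  sqm = joinMM (mergeArcs (λ ()) (λ { qᵐ _ → refl ; mᵐ x≢m → ⊥-elim (x≢m refl) ; sᵐ _ → refl }) refl)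
pushout false true  smq = joinMM (close refl λ { qᵐ _ () ; mᵐ x≢m → ⊥-elim (x≢m refl) ; sᵐ _ () })

arcs : ∀ {n} (K T : Subset n) → Arcs
arcs []      []      = sqm
arcs (b ∷ K) (c ∷ T) = rearrange b c (arcs K T)

cycles : ∀ {n} (K T : Subset n) → ℕ
cycles []      []      = 0
cycles (b ∷ K) (c ∷ T) = closing b c (arcs K T) + cycles K T

ladderSegments : ∀ {n} (K T : Subset n) → Segments n
ladderSegments K T = segments (R₁ K) (R₃ T) (R₂ K) (R₄ T)

-- From the segments to the vertices of a ladder surface

increasing-suc : ∀ n → increasing {suc n} ≡ zero ∷ map suc increasing
increasing-suc n = cong (zero ∷_) (sym (map-tabulate id suc))

decreasing-suc : ∀ n → decreasing {suc n} ≡ map suc decreasing ++ zero ∷ []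
decreasing-suc n = begin
  reverse (allFin (suc n))               ≡⟨ cong reverse (increasing-suc n) ⟩
  reverse (zero ∷ map suc increasing)    ≡⟨ unfold-reverse zero (map suc increasing) ⟩
  reverse (map suc increasing) ++ zero ∷ [] ≡⟨ cong (_++ zero ∷ []) (reverse-map suc increasing) ⟨
  map suc decreasing ++ zero ∷ []        ∎
  where open ≡-Reasoning

module _ {n} (b : Bool) (K : Subset n) where

  inSubset-suc : ∀ xs → inSubset (b ∷ K) (map suc xs) ≡ map suc (inSubset K xs)
  inSubset-suc []       = refl
  inSubset-suc (x ∷ xs) with does (x ∈ˢ? K)
  ... | true  = cong (suc x ∷_) (inSubset-suc xs)
  ... | false = inSubset-suc xs

  outSubset-suc : ∀ xs → outSubset (b ∷ K) (map suc xs) ≡ map suc (outSubset K xs)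
  outSubset-suc []       = refl
  outSubset-suc (x ∷ xs) with does (x ∈ˢ? K)
  ... | true  = outSubset-suc xs
  ... | false = cong (suc x ∷_) (outSubset-suc xs)

  inSubset-decreasing : inSubset (b ∷ K) decreasing ≡ map suc (inSubset K decreasing) ++ inSubset (b ∷ K) (zero ∷ [])
  inSubset-decreasing = begin
    inSubset (b ∷ K) decreasing                      ≡⟨ cong (inSubset (b ∷ K)) (decreasing-suc n) ⟩
    inSubset (b ∷ K) (map suc decreasing ++ zero ∷ []) ≡⟨ filter-++ (_∈ˢ? (b ∷ K)) (map suc decreasing) _ ⟩
    inSubset (b ∷ K) (map suc decreasing) ++ inSubset (b ∷ K) (zero ∷ [])
      ≡⟨ cong (_++ inSubset (b ∷ K) (zero ∷ [])) (inSubset-suc decreasing) ⟩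
    map suc (inSubset K decreasing) ++ inSubset (b ∷ K) (zero ∷ []) ∎
    where open ≡-Reasoning

outSubset-increasing : ∀ {n} b (K : Subset n) →
  outSubset (b ∷ K) increasing ≡ outSubset (b ∷ K) (zero ∷ []) ++ map suc (outSubset K increasing)
outSubset-increasing {n} b K = begin
  outSubset (b ∷ K) increasing                     ≡⟨ cong (outSubset (b ∷ K)) (increasing-suc n) ⟩
  outSubset (b ∷ K) ((zero ∷ []) ++ map suc increasing)
    ≡⟨ filter-++ (λ k → ¬? (k ∈ˢ? (b ∷ K))) (zero ∷ []) (map suc increasing) ⟩
  outSubset (b ∷ K) (zero ∷ []) ++ outSubset (b ∷ K) (map suc increasing)
    ≡⟨ cong (outSubset (b ∷ K) (zero ∷ []) ++_) (outSubset-suc b K increasing) ⟩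
  outSubset (b ∷ K) (zero ∷ []) ++ map suc (outSubset K increasing) ∎
  where open ≡-Reasoning

map-lift : ∀ {n} (t : Sign) (xs : List (Fin n)) → map (_, t) (map suc xs) ≡ map lift (map (_, t) xs)
map-lift t []       = refl
map-lift t (x ∷ xs) = cong (_ ∷_) (map-lift t xs)

in-segment : ∀ {n} (t : Sign) b (K : Subset n) →
             map (_, t) (inSubset (b ∷ K) decreasing) ≡
             map lift (map (_, t) (inSubset K decreasing)) ++ map (_, t) (inSubset (b ∷ K) (zero ∷ []))
in-segment t b K = begin
  map (_, t) (inSubset (b ∷ K) decreasing)
    ≡⟨ cong (map (_, t)) (inSubset-decreasing b K) ⟩
  map (_, t) (map suc (inSubset K decreasing) ++ inSubset (b ∷ K) (zero ∷ []))
    ≡⟨ map-++ (_, t) (map suc (inSubset K decreasing)) _ ⟩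
  map (_, t) (map suc (inSubset K decreasing)) ++ new
    ≡⟨ cong (_++ new) (map-lift t (inSubset K decreasing)) ⟩
  map lift (map (_, t) (inSubset K decreasing)) ++ new                          ∎
  where
  open ≡-Reasoning
  new = map (_, t) (inSubset (b ∷ K) (zero ∷ []))

out-segment : ∀ {n} (t : Sign) b (K : Subset n) →
              map (_, t) (outSubset (b ∷ K) increasing) ≡
              map (_, t) (outSubset (b ∷ K) (zero ∷ [])) ++ map lift (map (_, t) (outSubset K increasing))
out-segment t b K = begin
  map (_, t) (outSubset (b ∷ K) increasing)
    ≡⟨ cong (map (_, t)) (outSubset-increasing b K) ⟩
  map (_, t) (outSubset (b ∷ K) (zero ∷ []) ++ map suc (outSubset K increasing))
    ≡⟨ map-++ (_, t) (outSubset (b ∷ K) (zero ∷ [])) _ ⟩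
  new ++ map (_, t) (map suc (outSubset K increasing))
    ≡⟨ cong (new ++_) (map-lift t (outSubset K increasing)) ⟩
  new ++ map lift (map (_, t) (outSubset K increasing))                          ∎
  where
  open ≡-Reasoning
  new = map (_, t) (outSubset (b ∷ K) (zero ∷ []))

segments-cong : ∀ {n} {a b c d a′ b′ c′ d′ : List (SignedLetter n)} → a ≡ a′ → b ≡ b′ → c ≡ c′ → d ≡ d′ →
                segments a b c d ≡ segments a′ b′ c′ d′
segments-cong refl refl refl refl = refl

ladderSegments-∷ : ∀ {n} b c (K T : Subset n) → ladderSegments (b ∷ K) (c ∷ T) ≡ insert b c (ladderSegments K T)
ladderSegments-∷ true  true  K T = segments-cong
  (in-segment Sign.+ true K) (in-segment Sign.- true T)
  (out-segment Sign.+ true K) (out-segment Sign.- true T)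
ladderSegments-∷ true  false K T = segments-cong
  (in-segment Sign.+ true K) (trans (in-segment Sign.- false T) (++-identityʳ _))
  (out-segment Sign.+ true K) (out-segment Sign.- false T)
ladderSegments-∷ false true  K T = segments-cong
  (trans (in-segment Sign.+ false K) (++-identityʳ _)) (in-segment Sign.- true T)
  (out-segment Sign.+ false K) (out-segment Sign.- true T)
ladderSegments-∷ false false K T = segments-cong
  (trans (in-segment Sign.+ false K) (++-identityʳ _)) (trans (in-segment Sign.- false T) (++-identityʳ _))
  (out-segment Sign.+ false K) (out-segment Sign.- false T)

-- All segments are empty, so the arc ending at a mark starts at the preceding mark in the cyclic
-- order q, m, s. This makes `sqm` the initial state.
emptyLabelling : Labelling {0} (segments [] [] [] []) 0 ⟦ sqm ⟧
emptyLabelling = record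
  { v       = λ ()
  ; P       = arc sᵐ
  ; closed  = walks refl refl refl refl
  ; onto    = λ ()
  ; initial = λ { {start = start} (walks w₁ w₃ w₂ w₄) → (λ { (arc x) → start x }) , (λ ()) ,
                  fits (λ _ → refl) (λ { qᵐ → trans w₄ w₁ ; mᵐ → w₃ ; sᵐ → w₂ }) }
  }

labelling : ∀ {n} (K T : Subset n) → Labelling (ladderSegments K T) (cycles K T) ⟦ arcs K T ⟧
labelling []      []      = emptyLabelling
labelling (b ∷ K) (c ∷ T) =
  subst (λ S → Labelling S (cycles (b ∷ K) (c ∷ T)) ⟦ arcs (b ∷ K) (c ∷ T) ⟧) (sym (ladderSegments-∷ b c K T))
    (labelling-insert (pushout b c (arcs K T)) (labelling K T))

-- Vertices that pass through the marks

orbits : Arcs → ℕ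
orbits qms = 3
orbits qsm = 2
orbits mqs = 2
orbits smq = 2
orbits msq = 1
orbits sqm = 1

orbit : ∀ σ → Mark → Fin (orbits σ)
orbit qms = λ { qᵐ → zero ; mᵐ → suc zero ; sᵐ → suc (suc zero) }
orbit qsm = λ { qᵐ → zero ; mᵐ → suc zero ; sᵐ → suc zero }
orbit mqs = λ { qᵐ → zero ; mᵐ → zero ; sᵐ → suc zero }
orbit smq = λ { qᵐ → zero ; mᵐ → suc zero ; sᵐ → zero }
orbit msq = λ _ → zero
orbit sqm = λ _ → zero

representative : ∀ σ → Fin (orbits σ) → Mark
representative qms = λ { zero → qᵐ ; (suc zero) → mᵐ ; (suc (suc zero)) → sᵐ }
representative qsm = λ { zero → qᵐ ; (suc zero) → mᵐ }
representative mqs = λ { zero → qᵐ ; (suc zero) → sᵐ }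
representative smq = λ { zero → qᵐ ; (suc zero) → mᵐ }
representative msq = λ _ → qᵐ
representative sqm = λ _ → qᵐ

orbit-representative : ∀ σ j → orbit σ (representative σ j) ≡ j
orbit-representative qms = λ { zero → refl ; (suc zero) → refl ; (suc (suc zero)) → refl }
orbit-representative qsm = λ { zero → refl ; (suc zero) → refl }
orbit-representative mqs = λ { zero → refl ; (suc zero) → refl }
orbit-representative smq = λ { zero → refl ; (suc zero) → refl }
orbit-representative msq = λ { zero → refl }
orbit-representative sqm = λ { zero → refl }

orbit-invariant : ∀ σ x → orbit σ (⟦ σ ⟧ x) ≡ orbit σ x
orbit-invariant qms = λ { qᵐ → refl ; mᵐ → refl ; sᵐ → refl }
orbit-invariant qsm = λ { qᵐ → refl ; mᵐ → refl ; sᵐ → refl }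
orbit-invariant mqs = λ { qᵐ → refl ; mᵐ → refl ; sᵐ → refl }
orbit-invariant smq = λ { qᵐ → refl ; mᵐ → refl ; sᵐ → refl }
orbit-invariant msq = λ { qᵐ → refl ; mᵐ → refl ; sᵐ → refl }
orbit-invariant sqm = λ { qᵐ → refl ; mᵐ → refl ; sᵐ → refl }

representative-orbit : ∀ σ {D : Set} {f : Mark → D} → (∀ x → f (⟦ σ ⟧ x) ≡ f x) →
                       ∀ x → f (representative σ (orbit σ x)) ≡ f x
representative-orbit qms inv = λ { qᵐ → refl ; mᵐ → refl ; sᵐ → refl }
representative-orbit qsm inv = λ { qᵐ → refl ; mᵐ → refl ; sᵐ → inv sᵐ }
representative-orbit mqs inv = λ { qᵐ → refl ; mᵐ → inv mᵐ ; sᵐ → refl }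
representative-orbit smq inv = λ { qᵐ → refl ; mᵐ → refl ; sᵐ → inv sᵐ }
representative-orbit msq inv = λ { qᵐ → refl ; mᵐ → sym (inv qᵐ) ; sᵐ → inv sᵐ }
representative-orbit sqm inv = λ { qᵐ → refl ; mᵐ → inv mᵐ ; sᵐ → sym (inv qᵐ) }

-- The corner at the cut is where the first side of `ys` begins; if `ys` is empty, it is the base
-- corner, where the first side of `xs` begins.
closedWalk-visits : ∀ {n} {D : Set} (u : SignedLetter n → D) xs ys {c e} → xs ++ ys ≢ [] →
                    Walk u c xs e → Walk u e ys c → ∃[ ℓ ] u ℓ ≡ e
closedWalk-visits u []       []      ne p       r       = ⊥-elim (ne refl)
closedWalk-visits u (ℓ ∷ _)  []      ne (p , _) r       = ℓ , trans (sym p) (sym r)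
closedWalk-visits u _        (ℓ ∷ _) ne _       (r , _) = ℓ , sym r

-- The vertices of a polygon, characterised as the initial set of labels
-- that makes its boundary word a closed walk.
record VertexLabelling {n} (w : List (SignedLetter n)) (C : Set) : Set₁ where
  field
    v       : SignedLetter n → C
    P       : C
    closed  : Walk v P w P
    onto    : ∀ j → ∃[ ℓ ] v ℓ ≡ j
    initial : ∀ {D : Set} {u : SignedLetter n → D} {P′} → Walk u P′ w P′ →
              Σ[ g ∈ (C → D) ] (∀ ℓ → g (v ℓ) ≡ u ℓ)

wordOf : ∀ {n} → Segments n → List (SignedLetter n)
wordOf S = r₁ S ++ r₃ S ++ r₂ S ++ r₄ S

walks-word : ∀ {n} {S : Segments n} {D : Set} {u : SignedLetter n → D} {P} {f : Mark → D} →
             Walks S u P f f → Walk u P (wordOf S) P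
walks-word {S = S} {u = u} (walks w₁ w₃ w₂ w₄) =
  walk-++ u (r₁ S) w₁ (walk-++ u (r₃ S) w₃ (walk-++ u (r₂ S) w₂ w₄))

word-walks : ∀ {n} {S : Segments n} {D : Set} {u : SignedLetter n → D} {P} →
             Walk u P (wordOf S) P → ∃[ f ] Walks S u P f f
word-walks {S = S} {u = u} w
  with d₁ , w₁ , w₂₃₄ ← walk-split u (r₁ S) w
  with d₃ , w₃ , w₂₄ ← walk-split u (r₃ S) w₂₃₄
  with d₂ , w₂ , w₄ ← walk-split u (r₂ S) w₂₄
  = (λ { qᵐ → d₁ ; mᵐ → d₃ ; sᵐ → d₂ }) , walks w₁ w₃ w₂ w₄

walks-visit : ∀ {n} {S : Segments n} {D : Set} {u : SignedLetter n → D} {P} {f : Mark → D} → wordOf S ≢ [] →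
              Walks S u P f f → ∀ x → ∃[ ℓ ] u ℓ ≡ f x
walks-visit {S = S} {u = u} ne (walks w₁ w₃ w₂ w₄) = λ
  { qᵐ → closedWalk-visits u (r₁ S) (r₃ S ++ r₂ S ++ r₄ S) ne w₁
          (walk-++ u (r₃ S) w₃ (walk-++ u (r₂ S) w₂ w₄))
  ; mᵐ → closedWalk-visits u (r₁ S ++ r₃ S) (r₂ S ++ r₄ S) (ne ∘ trans (sym (++-assoc (r₁ S) (r₃ S) _)))
          (walk-++ u (r₁ S) w₁ w₃) (walk-++ u (r₂ S) w₂ w₄)
  ; sᵐ → closedWalk-visits u ((r₁ S ++ r₃ S) ++ r₂ S) (r₄ S)
          (ne ∘ trans (trans (sym (++-assoc (r₁ S) (r₃ S) _)) (sym (++-assoc (r₁ S ++ r₃ S) (r₂ S) _))))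
          (walk-++ u (r₁ S ++ r₃ S) (walk-++ u (r₁ S) w₁ w₃) w₂) w₄
  }

-- In the closed polygon each segment starts where the previous one ended. So `start` equals `end`,
-- which identifies `arc (π x)` with `arc x`, and the arcs fall together along the orbits of `σ`. A
-- nonempty word provides a side at each of these vertices.
closeUp : ∀ {n} {S : Segments n} {k} σ → wordOf S ≢ [] → Labelling S k ⟦ σ ⟧ →
          VertexLabelling (wordOf S) (Fin k ⊎ Fin (orbits σ))
closeUp {n} {S} {k} σ ne L = record
  { v       = v′
  ; P       = κ L.P
  ; closed  = walks-word closed′
  ; onto    = onto
  ; initial = initial
  }
  where
  module L = Labelling L
  κ : Label k → Fin k ⊎ Fin (orbits σ)
  κ (cyc j) = inj₁ j
  κ (arc x) = inj₂ (orbit σ x)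

  v′ = κ ∘ L.v

  closed′ : Walks S v′ (κ L.P) (inj₂ ∘ orbit σ) (inj₂ ∘ orbit σ)
  closed′ = walks-map κ (λ _ → refl) (λ _ → refl) (cong inj₂ ∘ orbit-invariant σ) L.closed

  onto : ∀ j → ∃[ ℓ ] v′ ℓ ≡ j
  onto (inj₁ j) with ℓ , vℓ ← L.onto j = ℓ , cong κ vℓ
  onto (inj₂ j) with ℓ , vℓ ← walks-visit ne closed′ (representative σ j) =
    ℓ , trans vℓ (cong inj₂ (orbit-representative σ j))

  initial : ∀ {D : Set} {u : SignedLetter n → D} {P′} → Walk u P′ (wordOf S) P′ →
            Σ[ g ∈ (Fin k ⊎ Fin (orbits σ) → D) ] (∀ ℓ → g (v′ ℓ) ≡ u ℓ)
  initial {D} {u} w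
    with f , ws ← word-walks {S = S} w
    with g , gv , fits gs ge ← L.initial ws
    = g′ , λ ℓ → trans (g′κ (L.v ℓ)) (gv ℓ)
    where
    g′ : Fin k ⊎ Fin (orbits σ) → D
    g′ (inj₁ j) = g (cyc j)
    g′ (inj₂ j) = g (arc (representative σ j))
    g′κ : ∀ z → g′ (κ z) ≡ g z
    g′κ (cyc j) = refl
    g′κ (arc x) = representative-orbit σ {f = g ∘ inj₂} (λ y → trans (ge y) (sym (gs y))) x

-- Initial labellings count equivalence classes of corners

next-fromℕ : ∀ N → next (fromℕ N) ≡ zero
next-fromℕ N = toℕ-injective (trans (toℕ-fromℕ< _) (trans (cong (λ k → suc k % suc N) (toℕ-fromℕ N)) (n%n≡0 (suc N))))

next-inject₁ : ∀ {N} (i : Fin N) → next (inject₁ i) ≡ suc i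
next-inject₁ {N} i = toℕ-injective (trans (toℕ-fromℕ< _)
  (trans (cong (λ k → suc k % suc N) (toℕ-inject₁ i)) (m<n⇒m%n≡m (s≤s (toℕ<n i)))))

module _ {n : ℕ} {D : Set} (u : SignedLetter n → D) where

  walk-inner : ∀ ℓ w {c d} → Walk u c (ℓ ∷ w) d → ∀ i → u (lookup w i) ≡ u (lookup (ℓ ∷ w) (inject₁ i) ⁻)
  walk-inner ℓ (ℓ′ ∷ w) (_ , p) zero    = sym (proj₁ p)
  walk-inner ℓ (ℓ′ ∷ w) (_ , p) (suc i) = walk-inner ℓ′ w p i

  walk-last : ∀ ℓ w {c d} → Walk u c (ℓ ∷ w) d → u (lookup (ℓ ∷ w) (fromℕ (length w)) ⁻) ≡ d
  walk-last ℓ []       (_ , p) = p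
  walk-last ℓ (ℓ′ ∷ w) (_ , p) = walk-last ℓ′ w p

  walk-tabulate : ∀ ℓ w {d} → (∀ i → u (lookup w i) ≡ u (lookup (ℓ ∷ w) (inject₁ i) ⁻)) →
                  u (lookup (ℓ ∷ w) (fromℕ (length w)) ⁻) ≡ d → Walk u (u ℓ) (ℓ ∷ w) d
  walk-tabulate ℓ []       f e = refl , e
  walk-tabulate ℓ (ℓ′ ∷ w) f e = refl , subst (λ c → Walk u c (ℓ′ ∷ w) _) (f zero) (walk-tabulate ℓ′ w (f ∘ suc) e)

  -- Together with `next⇒walk` this makes a closed walk a condition at each corner separately. The
  -- last side is singled out because there `next` returns to the first corner and the closing of
  -- the walk is used.
  walk⇒next : ∀ w {P} → Walk u P w P → ∀ j → u (lookup w (next j)) ≡ u (lookup w j ⁻)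
  walk⇒next (ℓ ∷ w) p j with view j
  ... | ‵fromℕ     rewrite next-fromℕ (length w) = trans (sym (proj₁ p)) (sym (walk-last ℓ w p))
  ... | ‵inject₁ i rewrite next-inject₁ i        = walk-inner ℓ w p i

  next⇒walk : ∀ w → w ≢ [] → (∀ j → u (lookup w (next j)) ≡ u (lookup w j ⁻)) → ∃[ P ] Walk u P w P
  next⇒walk []      ne f = ⊥-elim (ne refl)
  next⇒walk (ℓ ∷ w) ne f = u ℓ , walk-tabulate ℓ w
    (λ i → trans (cong (u ∘ lookup (ℓ ∷ w)) (sym (next-inject₁ i))) (f (inject₁ i)))
    (trans (sym (f (fromℕ (length w)))) (cong (u ∘ lookup (ℓ ∷ w)) (next-fromℕ (length w))))

lookup-AllPairs : ∀ {A : Set} {R : A → A → Set} {xs} → Symmetric R → AllPairs (λ x y → ¬ R x y) xs →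
                  ∀ i j → R (lookup xs i) (lookup xs j) → i ≡ j
lookup-AllPairs sym′ (px ∷ p) zero    zero    r = refl
lookup-AllPairs sym′ (px ∷ p) zero    (suc j) r = ⊥-elim (All.lookup px (∈-lookup j) r)
lookup-AllPairs sym′ (px ∷ p) (suc i) zero    r = ⊥-elim (All.lookup px (∈-lookup i) (sym′ r))
lookup-AllPairs sym′ (px ∷ p) (suc i) (suc j) r = cong suc (lookup-AllPairs sym′ p i j r)

module Classes {N : ℕ} {_≈_ : Fin N → Fin N → Set} (isEquiv : IsEquivalence _≈_) (_≈?_ : Decidable _≈_) where
  private
    module ≈ = IsEquivalence isEquiv

    decSetoid : DecSetoid _ _
    decSetoid = record { isDecEquivalence = record { isEquivalence = isEquiv ; _≟_ = _≈?_ } }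

  representatives : List (Fin N)
  representatives = deduplicate _≈?_ (allFin N)

  private
    found : ∀ x → Any (_≈ x) representatives
    found x = deduplicate⁺ _≈?_ (λ p r → ≈.trans p r) (Any.map (λ { refl → ≈.refl }) (∈-allFin x))

    lookup-injective : ∀ i j → lookup representatives i ≈ lookup representatives j → i ≡ j
    lookup-injective = lookup-AllPairs ≈.sym (deduplicate-! decSetoid (allFin N))

  class : Fin N → Fin (length representatives)
  class x = Any.index (found x)

  private
    lookup-class : ∀ x → lookup representatives (class x) ≈ x
    lookup-class x = lookup-index (found x)

  class-cong : ∀ {x y} → x ≈ y → class x ≡ class y
  class-cong {x} {y} r = lookup-injective _ _ (≈.trans (lookup-class x) (≈.trans r (≈.sym (lookup-class y))))

  class-reflects : ∀ {x y} → class x ≡ class y → x ≈ y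
  class-reflects {x} {y} e = ≈.trans (≈.sym (lookup-class x))
    (≈.trans (≈.reflexive (cong (lookup representatives) e)) (lookup-class y))

  -- `f` injects the representatives into `Fin k`, and the classes of chosen preimages give an
  -- injection back.
  length-representatives : ∀ {k} (f : Fin N → Fin k) → (∀ j → ∃[ x ] f x ≡ j) →
    (∀ {x y} → x ≈ y → f x ≡ f y) → (∀ {x y} → f x ≡ f y → x ≈ y) → length representatives ≡ k
  length-representatives f onto f-cong f-reflects =
    cantor-schröder-bernstein {f = f ∘ lookup representatives} {g = class ∘ proj₁ ∘ onto}
      (lookup-injective _ _ ∘ f-reflects)
      (λ {i} {j} e → trans (sym (proj₂ (onto i))) (trans (f-cong (class-reflects e)) (proj₂ (onto j))))

⁻-involutive : ∀ {n} (ℓ : SignedLetter n) → ℓ ⁻ ⁻ ≡ ℓ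
⁻-involutive (k , Sign.+) = refl
⁻-involutive (k , Sign.-) = refl

module _ {n : ℕ} (S : Surface n) (all : ∀ ℓ → ℓ ∈ Surface.word S) (ne : Surface.word S ≢ []) where
  open Surface S
  open Classes (Eq.isEquivalence (Glued S)) (sameVertex? S)

  private
    pos : SignedLetter n → Fin (sides S)
    pos ℓ = Any.index (all ℓ)

    lookup-pos : ∀ ℓ → lookup word (pos ℓ) ≡ ℓ
    lookup-pos ℓ = sym (lookup-index (all ℓ))

    pos-lookup : ∀ x → pos (lookup word x) ≡ x
    pos-lookup x = lookup-AllPairs sym unique _ _ (lookup-pos (lookup word x))

    glued : ∀ j → Glued S (pos (lookup word j ⁻)) (next j)
    glued j = j , trans (sym (⁻-involutive _)) (cong _⁻ (sym (lookup-pos (lookup word j ⁻)))) , refl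

    class-walk : ∃[ P ] Walk (class ∘ pos) P word P
    class-walk = next⇒walk (class ∘ pos) word ne λ j →
      trans (cong class (pos-lookup (next j))) (sym (class-cong (Eq.return (glued j))))

  -- `f` is constant on vertices because its labels form a closed walk. It separates them because
  -- the classes label a closed walk too, so that initiality factors `class` through `f`.
  vertices-labelled : ∀ {k} → VertexLabelling word (Fin k) → vertices S ≡ k
  vertices-labelled {k} L = length-representatives f
    (λ j → let ℓ , vℓ = L.onto j in pos ℓ , trans (cong L.v (lookup-pos ℓ)) vℓ)
    f-cong (λ {x} {y} e → class-reflects (trans (sym (g∘f x)) (trans (cong g e) (g∘f y))))
    where
    module L = VertexLabelling L

    f : Fin (sides S) → Fin k
    f = L.v ∘ lookup word

    f-cong : ∀ {x y} → SameVertex S x y → f x ≡ f y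
    f-cong = Eq.gfold isEquivalence f λ { {x} (j , e , refl) → sym (begin
      L.v (lookup word (next j)) ≡⟨ walk⇒next L.v word L.closed j ⟩
      L.v (lookup word j ⁻)      ≡⟨ cong (L.v ∘ _⁻) e ⟩
      L.v (lookup word x ⁻ ⁻)    ≡⟨ cong L.v (⁻-involutive _) ⟩
      L.v (lookup word x)        ∎) }
      where open ≡-Reasoning

    factor = L.initial (proj₂ class-walk)

    g : Fin k → Fin (length representatives)
    g = proj₁ factor

    g∘f : ∀ x → g (f x) ≡ class x
    g∘f x = trans (proj₂ factor (lookup word x)) (cong class (pos-lookup x))

vertexLabelling-↔ : ∀ {n} {w : List (SignedLetter n)} {C C′ : Set} → C ↔ C′ → VertexLabelling w C → VertexLabelling w C′
vertexLabelling-↔ {w = w} iso L = record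
  { v       = to ∘ L.v
  ; P       = to L.P
  ; closed  = walk-map to (λ _ → refl) w L.closed
  ; onto    = λ j → let ℓ , vℓ = L.onto (from j) in ℓ , trans (cong to vℓ) (inverseˡ refl)
  ; initial = λ walk → let g , gv = L.initial walk in
                g ∘ from , λ ℓ → trans (cong g (inverseʳ refl)) (gv ℓ)
  }
  where
  module L = VertexLabelling L
  open Inverse iso using (to; from; inverseˡ; inverseʳ)

-- Edges, Euler characteristic and genus

length-insert : ∀ {n} b c (S : Segments n) → length (wordOf (insert b c S)) ≡ 2 + length (wordOf S)
length-insert b c S = trans (lengths (insert b c S)) (trans (go b c) (cong (λ k → 2 + k) (sym (lengths S))))
  where
  lengths : ∀ {n} (S : Segments n) →
            length (wordOf S) ≡ length (r₁ S) + (length (r₃ S) + (length (r₂ S) + length (r₄ S)))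
  lengths S
    rewrite length-++ (r₁ S) {r₃ S ++ r₂ S ++ r₄ S} | length-++ (r₃ S) {r₂ S ++ r₄ S} | length-++ (r₂ S) {r₄ S} = refl

  snoc : ∀ x (r : List (SignedLetter _)) → length (map lift r ++ x ∷ []) ≡ suc (length r)
  snoc x r rewrite length-++ (map lift r) {x ∷ []} | length-map lift r = +-comm (length r) 1

  l₁ = length (r₁ S)
  l₃ = length (r₃ S)
  l₂ = length (r₂ S)
  l₄ = length (r₄ S)

  go : ∀ b c → let S′ = insert b c S in
       length (r₁ S′) + (length (r₃ S′) + (length (r₂ S′) + length (r₄ S′))) ≡ 2 + (l₁ + (l₃ + (l₂ + l₄)))
  go true  true  rewrite snoc (a⁺ zero) (r₁ S) | snoc (a⁻ zero) (r₃ S) | length-map lift (r₂ S) | length-map lift (r₄ S)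
    = arith l₁ l₃ l₂ l₄
    where
    arith : ∀ w x y z → suc w + (suc x + (y + z)) ≡ 2 + (w + (x + (y + z)))
    arith = solve-∀
  go true  false rewrite snoc (a⁺ zero) (r₁ S) | length-map lift (r₃ S) | length-map lift (r₂ S) | length-map lift (r₄ S)
    = arith l₁ l₃ l₂ l₄
    where
    arith : ∀ w x y z → suc w + (x + (y + suc z)) ≡ 2 + (w + (x + (y + z)))
    arith = solve-∀
  go false true  rewrite length-map lift (r₁ S) | snoc (a⁻ zero) (r₃ S) | length-map lift (r₂ S) | length-map lift (r₄ S)
    = arith l₁ l₃ l₂ l₄
    where
    arith : ∀ w x y z → w + (suc x + (suc y + z)) ≡ 2 + (w + (x + (y + z)))
    arith = solve-∀
  go false false rewrite length-map lift (r₁ S) | length-map lift (r₃ S) | length-map lift (r₂ S) | length-map lift (r₄ S)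
    = arith l₁ l₃ l₂ l₄
    where
    arith : ∀ w x y z → w + (x + (suc y + suc z)) ≡ 2 + (w + (x + (y + z)))
    arith = solve-∀

length-ladderWord : ∀ {n} (K T : Subset n) → length (ladderWord K T) ≡ n + n
length-ladderWord []      []      = refl
length-ladderWord {suc n} (b ∷ K) (c ∷ T) = begin
  length (wordOf (ladderSegments (b ∷ K) (c ∷ T))) ≡⟨ cong (length ∘ wordOf) (ladderSegments-∷ b c K T) ⟩
  length (wordOf (insert b c (ladderSegments K T))) ≡⟨ length-insert b c (ladderSegments K T) ⟩
  2 + length (ladderWord K T)                      ≡⟨ cong (λ k → 2 + k) (length-ladderWord K T) ⟩
  suc (suc (n + n))                                ≡⟨ cong suc (+-suc n n) ⟨
  suc n + suc n                                    ∎
  where open ≡-Reasoning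

edges-ladder : ∀ {n} (K T : Subset n) → edges (ladder K T) ≡ n
edges-ladder {n} K T = trans (cong ⌊_/2⌋ (length-ladderWord K T)) (sym (n≡⌊n+n/2⌋ n))

ladderWord-≢[] : ∀ {n} (K T : Subset (suc n)) → ladderWord K T ≢ []
ladderWord-≢[] K T e with () ← trans (sym (length-ladderWord K T)) (cong length e)

vertices-ladder : ∀ {n} (K T : Subset (suc n)) → vertices (ladder K T) ≡ cycles K T + orbits (arcs K T)
vertices-ladder K T = vertices-labelled (ladder K T) (ladder-all K T) (ladderWord-≢[] K T)
  (vertexLabelling-↔ iso (closeUp (arcs K T) (ladderWord-≢[] K T) (labelling K T)))
  where
  iso = ↔-sym (+↔⊎ {cycles K T} {orbits (arcs K T)})

-- An insertion adds one edge, so the genus grows by half of one minus the growth of the number of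
-- vertices. The table is this number, as `gain-euler` confirms.
gain : (b c : Bool) → Arcs → ℕ
gain false true  _   = 0
gain true  true  qms = 1
gain true  false qms = 1
gain false false qms = 1
gain true  true  qsm = 1
gain true  false qsm = 1
gain true  false mqs = 1
gain false false mqs = 1
gain true  true  smq = 1
gain false false smq = 1
gain _     _     _   = 0

genus : ∀ {n} (K T : Subset n) → ℕ
genus []      []      = 0
genus (b ∷ K) (c ∷ T) = gain b c (arcs K T) + genus K T

gain-euler : ∀ b c σ → closing b c σ + orbits (rearrange b c σ) + 2 * gain b c σ ≡ suc (orbits σ)
gain-euler true  true  qms = refl
gain-euler true  true  qsm = refl
gain-euler true  true  mqs = refl
gain-euler true  true  msq = refl
gain-euler true  true  sqm = refl
gain-euler true  true  smq = refl
gain-euler true  false qms = refl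
gain-euler true  false qsm = refl
gain-euler true  false mqs = refl
gain-euler true  false msq = refl
gain-euler true  false sqm = refl
gain-euler true  false smq = refl
gain-euler false true  qms = refl
gain-euler false true  qsm = refl
gain-euler false true  mqs = refl
gain-euler false true  msq = refl
gain-euler false true  sqm = refl
gain-euler false true  smq = refl
gain-euler false false qms = refl
gain-euler false false qsm = refl
gain-euler false false mqs = refl
gain-euler false false msq = refl
gain-euler false false sqm = refl
gain-euler false false smq = refl

genus-euler : ∀ {n} (K T : Subset n) → cycles K T + orbits (arcs K T) + 2 * genus K T ≡ suc n
genus-euler []      []      = refl
genus-euler {suc n} (b ∷ K) (c ∷ T) = begin
  (x + k) + o′ + 2 * (y + g)       ≡⟨ shuffle x k o′ y g ⟩
  (x + o′ + 2 * y) + (k + 2 * g)   ≡⟨ cong (_+ (k + 2 * g)) (gain-euler b c (arcs K T)) ⟩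
  suc o + (k + 2 * g)              ≡⟨ shuffle′ o k g ⟩
  suc (k + o + 2 * g)              ≡⟨ cong suc (genus-euler K T) ⟩
  suc (suc n)                      ∎
  where
  open ≡-Reasoning
  x = closing b c (arcs K T)
  y = gain b c (arcs K T)
  k = cycles K T
  g = genus K T
  o = orbits (arcs K T)
  o′ = orbits (arcs (b ∷ K) (c ∷ T))
  shuffle : ∀ x k o y g → (x + k) + o + 2 * (y + g) ≡ (x + o + 2 * y) + (k + 2 * g)
  shuffle = solve-∀
  shuffle′ : ∀ o k g → suc o + (k + 2 * g) ≡ suc (k + o + 2 * g)
  shuffle′ = solve-∀

euler-genus : ∀ {V n γ} → V + 2 * γ ≡ suc n → int V ℤ.- int n ℤ.+ int 1 ≡ int 2 ℤ.- int 2 ℤ.* int γ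
euler-genus {V} {n} {γ} e = begin
  int V ℤ.- int n ℤ.+ int 1                                       ≡⟨ ring₁ (int V) (int n) (int γ) ⟩
  (int V ℤ.+ int 2 ℤ.* int γ) ℤ.- int n ℤ.+ int 1 ℤ.- int 2 ℤ.* int γ
    ≡⟨ cong (λ z → z ℤ.- int n ℤ.+ int 1 ℤ.- int 2 ℤ.* int γ) e′ ⟩
  (int 1 ℤ.+ int n) ℤ.- int n ℤ.+ int 1 ℤ.- int 2 ℤ.* int γ             ≡⟨ ring₂ (int n) (int γ) ⟩
  int 2 ℤ.- int 2 ℤ.* int γ                                       ∎
  where
  open ≡-Reasoning
  e′ : int V ℤ.+ int 2 ℤ.* int γ ≡ int 1 ℤ.+ int n
  e′ = trans (cong (λ z → int V ℤ.+ z) (sym (ℤ.pos-* 2 γ))) (cong int e)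
  ring₁ : ∀ v n g → v ℤ.- n ℤ.+ int 1 ≡ (v ℤ.+ int 2 ℤ.* g) ℤ.- n ℤ.+ int 1 ℤ.- int 2 ℤ.* g
  ring₁ = ℤSolver.solve-∀
  ring₂ : ∀ n g → (int 1 ℤ.+ n) ℤ.- n ℤ.+ int 1 ℤ.- int 2 ℤ.* g ≡ int 2 ℤ.- int 2 ℤ.* g
  ring₂ = ℤSolver.solve-∀

genus-injective : ∀ {γ i} → int 2 ℤ.- int 2 ℤ.* int γ ≡ int 2 ℤ.- int 2 ℤ.* int i → γ ≡ i
genus-injective {γ} {i} e =
  ℤ.+-injective (ℤ.*-cancelˡ-≡ (int 2) (int γ) (int i) (ℤ.neg-injective (∙-cancelˡ ℤ.+-0-abelianGroup (int 2) _ _ e)))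

module _ {n} (K T : Subset (suc n)) where

  euler-ladder : eulerCharacteristic (ladder K T) ≡ int 2 ℤ.- int 2 ℤ.* int (genus K T)
  euler-ladder = trans (cong₂ (λ V E → int V ℤ.- int E ℤ.+ int 1) (vertices-ladder K T) (edges-ladder K T))
                       (euler-genus {cycles K T + orbits (arcs K T)} {γ = genus K T} (genus-euler K T))

  hasGenus⁺ : HasGenus (ladder K T) (genus K T)
  hasGenus⁺ = euler-ladder

  hasGenus⁻ : ∀ {i} → HasGenus (ladder K T) i → genus K T ≡ i
  hasGenus⁻ h = genus-injective (trans (sym euler-ladder) h)

-- Counting surfaces by genus

∑ : ∀ {A : Set} → List A → (A → ℕ) → ℕ
∑ []       w = 0
∑ (x ∷ xs) w = w x + ∑ xs w

∑-++ : ∀ {A : Set} (xs ys : List A) w → ∑ (xs ++ ys) w ≡ ∑ xs w + ∑ ys w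
∑-++ []       ys w = refl
∑-++ (x ∷ xs) ys w = trans (cong (w x +_) (∑-++ xs ys w)) (sym (+-assoc (w x) _ _))

∑-map : ∀ {A B : Set} (f : A → B) xs w → ∑ (map f xs) w ≡ ∑ xs (w ∘ f)
∑-map f []       w = refl
∑-map f (x ∷ xs) w = cong (w (f x) +_) (∑-map f xs w)

∑-cong : ∀ {A : Set} (xs : List A) {w w′} → (∀ x → w x ≡ w′ x) → ∑ xs w ≡ ∑ xs w′
∑-cong []       e = refl
∑-cong (x ∷ xs) e = cong₂ _+_ (e x) (∑-cong xs e)

∑-+ : ∀ {A : Set} (xs : List A) w w′ → ∑ xs (λ x → w x + w′ x) ≡ ∑ xs w + ∑ xs w′
∑-+ []       w w′ = refl
∑-+ (x ∷ xs) w w′ = trans (cong ((w x + w′ x) +_) (∑-+ xs w w′)) (interchange (w x) (w′ x) (∑ xs w) (∑ xs w′))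
  where
  interchange : ∀ a b c d → (a + b) + (c + d) ≡ (a + c) + (b + d)
  interchange = solve-∀

∑-product : ∀ {A B C : Set} (f : A → B → C) xs ys w →
            ∑ (cartesianProductWith f xs ys) w ≡ ∑ xs λ x → ∑ ys λ y → w (f x y)
∑-product f []       ys w = refl
∑-product f (x ∷ xs) ys w = trans (∑-++ (map (f x) ys) _ w) (cong₂ _+_ (∑-map (f x) ys w) (∑-product f xs ys w))

indicator : Bool → ℕ
indicator b = if b then 1 else 0

length-filter-∑ : ∀ {A : Set} {P : A → Set} (P? : Unary.Decidable P) xs →
                  length (filter P? xs) ≡ ∑ xs (λ x → indicator (does (P? x)))
length-filter-∑ P? []       = refl
length-filter-∑ P? (x ∷ xs) with does (P? x)
... | true  = cong suc (length-filter-∑ P? xs)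
... | false = length-filter-∑ P? xs

∑∑ : ∀ n → (Subset n → Subset n → ℕ) → ℕ
∑∑ n w = ∑ (subsets n) λ K → ∑ (subsets n) λ T → w K T

∑-subsets : ∀ n (w : Subset (suc n) → ℕ) →
            ∑ (subsets (suc n)) w ≡ ∑ (subsets n) (λ K → w (false ∷ K)) + ∑ (subsets n) (λ K → w (true ∷ K))
∑-subsets n w = trans (∑-++ (map (false ∷_) (subsets n)) _ w)
  (cong₂ _+_ (∑-map (false ∷_) (subsets n) w) (∑-map (true ∷_) (subsets n) w))

∑∑-suc : ∀ n (w : Subset (suc n) → Subset (suc n) → ℕ) → ∑∑ (suc n) w ≡
         ∑∑ n (λ K T → (w (false ∷ K) (false ∷ T) + w (false ∷ K) (true ∷ T))
                     + (w (true ∷ K) (false ∷ T) + w (true ∷ K) (true ∷ T)))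
∑∑-suc n w = begin
  ∑∑ (suc n) w                                              ≡⟨ ∑-subsets n _ ⟩
  ∑ S (row false) + ∑ S (row true)                          ≡⟨ ∑-+ S (row false) (row true) ⟨
  ∑ S (λ K → row false K + row true K)                      ≡⟨ ∑-cong S rows ⟩
  ∑ S (λ K → ∑ S λ T → entry false K T + entry true K T)    ∎
  where
  open ≡-Reasoning
  S = subsets n
  row : Bool → Subset n → ℕ
  row b K = ∑ (subsets (suc n)) (w (b ∷ K))
  entry : Bool → Subset n → Subset n → ℕ
  entry b K T = w (b ∷ K) (false ∷ T) + w (b ∷ K) (true ∷ T)
  row-entry : ∀ b K → row b K ≡ ∑ S (entry b K)
  row-entry b K = trans (∑-subsets n (w (b ∷ K))) (sym (∑-+ S _ _))
  rows : ∀ K → row false K + row true K ≡ ∑ S λ T → entry false K T + entry true K T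
  rows K = trans (cong₂ _+_ (row-entry false K) (row-entry true K)) (sym (∑-+ S _ _))

-- The transfer operator of the automaton, acting on functions of the state and the genus
-- accumulated so far.
pull : (Arcs → ℕ → ℕ) → Arcs → ℕ → ℕ
pull w σ γ = (at false false + at false true) + (at true false + at true true)
  where
  at : Bool → Bool → ℕ
  at b c = w (rearrange b c σ) (gain b c σ + γ)

pulls : ℕ → (Arcs → ℕ → ℕ) → Arcs → ℕ → ℕ
pulls zero    w = w
pulls (suc n) w = pull (pulls n w)

-- The head of a subset is the letter inserted last, so sums over subsets peel off the last step of
-- a run, whereas `pulls` and `paths` peel off the first.
pulls-pull : ∀ n w σ γ → pulls n (pull w) σ γ ≡ pull (pulls n w) σ γ
pulls-pull zero    w σ γ = refl
pulls-pull (suc n) w σ γ = cong₂ _+_ (cong₂ _+_ (pulls-pull n w _ _) (pulls-pull n w _ _))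
                                     (cong₂ _+_ (pulls-pull n w _ _) (pulls-pull n w _ _))

∑∑-pulls : ∀ n w → ∑∑ n (λ K T → w (arcs K T) (genus K T)) ≡ pulls n w sqm 0
∑∑-pulls zero    w = trans (+-identityʳ _) (+-identityʳ _)
∑∑-pulls (suc n) w = begin
  ∑∑ (suc n) (λ K T → w (arcs K T) (genus K T)) ≡⟨ ∑∑-suc n _ ⟩
  ∑∑ n (λ K T → pull w (arcs K T) (genus K T))  ≡⟨ ∑∑-pulls n (pull w) ⟩
  pulls n (pull w) sqm 0                        ≡⟨ pulls-pull n w sqm 0 ⟩
  pulls (suc n) w sqm 0                         ∎
  where open ≡-Reasoning

-- Multiplication of a generating function by the power `k` of its variable, on coefficients.
shift : ℕ → (ℕ → ℕ) → ℕ → ℕ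
shift zero    f i       = f i
shift (suc k) f zero    = 0
shift (suc k) f (suc i) = shift k f i

paths : ℕ → Arcs → ℕ → ℕ
paths zero    σ zero    = 1
paths zero    σ (suc i) = 0
paths (suc n) σ i       = (to false false + to false true) + (to true false + to true true)
  where
  to : Bool → Bool → ℕ
  to b c = shift (gain b c σ) (paths n (rearrange b c σ)) i

genusIs : ℕ → Arcs → ℕ → ℕ
genusIs i σ γ = indicator (γ ≡ᵇ i)

≡ᵇ-refl : ∀ γ → indicator (γ ≡ᵇ γ + 0) ≡ 1
≡ᵇ-refl zero    = refl
≡ᵇ-refl (suc γ) = ≡ᵇ-refl γ

≡ᵇ-above : ∀ γ k → indicator (γ ≡ᵇ γ + suc k) ≡ 0
≡ᵇ-above zero    k = refl
≡ᵇ-above (suc γ) k = ≡ᵇ-above γ k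

≡ᵇ-below : ∀ k i → indicator (suc k + i ≡ᵇ i) ≡ 0
≡ᵇ-below k zero    = refl
≡ᵇ-below k (suc i) rewrite +-suc k i = ≡ᵇ-below k i

-- The accumulated genus never decreases, so a run that has passed `i` cannot count any more. This
-- supplies the zeros produced by `shift`.
pulls-beyond : ∀ n σ k i → pulls n (genusIs i) σ (suc k + i) ≡ 0
pulls-beyond zero    σ k i = ≡ᵇ-below k i
pulls-beyond (suc n) σ k i = cong₂ _+_ (cong₂ _+_ (go false false) (go false true)) (cong₂ _+_ (go true false) (go true true))
  where
  go : ∀ b c → pulls n (genusIs i) (rearrange b c σ) (gain b c σ + (suc k + i)) ≡ 0
  go b c = trans (cong (pulls n (genusIs i) (rearrange b c σ)) (move (gain b c σ) k i)) (pulls-beyond n _ (gain b c σ + k) i)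
    where
    move : ∀ g k i → g + (suc k + i) ≡ suc (g + k) + i
    move = solve-∀

pulls-paths : ∀ n σ γ k → pulls n (genusIs (γ + k)) σ γ ≡ paths n σ k
pulls-paths zero    σ γ zero    = ≡ᵇ-refl γ
pulls-paths zero    σ γ (suc k) = ≡ᵇ-above γ k
pulls-paths (suc n) σ γ k = cong₂ _+_ (cong₂ _+_ (go false false) (go false true)) (cong₂ _+_ (go true false) (go true true))
  where
  shifted : ∀ g k σ → pulls n (genusIs (γ + k)) σ (g + γ) ≡ shift g (paths n σ) k
  shifted g k σ = trans (from g γ k) (shifts g k)
    where
    from : ∀ g γ k → pulls n (genusIs (γ + k)) σ (g + γ) ≡ shift g (λ j → pulls n (genusIs (g + γ + j)) σ (g + γ)) k
    from zero    γ k       = refl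
    from (suc g) γ zero    = trans (cong (λ i → pulls n (genusIs i) σ (suc g + γ)) (+-identityʳ γ)) (pulls-beyond n σ g γ)
    from (suc g) γ (suc k) = begin
      pulls n (genusIs (γ + suc k)) σ (suc (g + γ))
        ≡⟨ cong₂ (λ i j → pulls n (genusIs i) σ j) (+-suc γ k) (sym (+-suc g γ)) ⟩
      pulls n (genusIs (suc γ + k)) σ (g + suc γ)    ≡⟨ from g (suc γ) k ⟩
      shift g (λ j → pulls n (genusIs (g + suc γ + j)) σ (g + suc γ)) k
        ≡⟨ cong (λ z → shift g (λ j → pulls n (genusIs (z + j)) σ z) k) (+-suc g γ) ⟩
      shift g (λ j → pulls n (genusIs (suc g + γ + j)) σ (suc g + γ)) k ∎
      where open ≡-Reasoning
    shifts : ∀ g′ k → shift g′ (λ j → pulls n (genusIs (g + γ + j)) σ (g + γ)) k ≡ shift g′ (paths n σ) k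
    shifts zero     k       = pulls-paths n σ (g + γ) k
    shifts (suc g′) zero    = refl
    shifts (suc g′) (suc k) = shifts g′ k

  go : ∀ b c → pulls n (genusIs (γ + k)) (rearrange b c σ) (gain b c σ + γ) ≡ shift (gain b c σ) (paths n (rearrange b c σ)) k
  go b c = shifted (gain b c σ) k (rearrange b c σ)

does-hasGenus : ∀ {n} (K T : Subset (suc n)) i → does (hasGenus? (ladder K T) i) ≡ (genus K T ≡ᵇ i)
does-hasGenus K T i = equal (hasGenus? (ladder K T) i) (genus K T ≟ i)
  where
  equal : (p : Dec (HasGenus (ladder K T) i)) (p′ : Dec (genus K T ≡ i)) → does p ≡ (genus K T ≡ᵇ i)
  equal (yes h) _        = sym (dec-true (genus K T ≟ i) (hasGenus⁻ K T h))
  equal (no ¬h) (yes refl) = ⊥-elim (¬h (hasGenus⁺ K T))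
  equal (no ¬h) (no ¬e)  = sym (dec-false (genus K T ≟ i) ¬e)

g₃-paths : ∀ n i → g₃ (suc n) i ≡ paths (suc n) sqm i
g₃-paths n i = begin
  g₃ (suc n) i
    ≡⟨ length-filter-∑ (λ S → hasGenus? S i) (𝒮₃ (suc n)) ⟩
  ∑ (𝒮₃ (suc n)) (λ S → indicator (does (hasGenus? S i)))                      ≡⟨ ∑-product ladder S S _ ⟩
  ∑∑ (suc n) (λ K T → indicator (does (hasGenus? (ladder K T) i)))
    ≡⟨ ∑-cong S (λ K → ∑-cong S λ T → cong indicator (does-hasGenus K T i)) ⟩
  ∑∑ (suc n) (λ K T → genusIs i (arcs K T) (genus K T))
    ≡⟨ ∑∑-pulls (suc n) (genusIs i) ⟩
  pulls (suc n) (genusIs i) sqm 0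
    ≡⟨ pulls-paths (suc n) sqm 0 i ⟩
  paths (suc n) sqm i                                                          ∎
  where
  open ≡-Reasoning
  S = subsets (suc n)

-- Recurrences for the counts

-- qsm and mqs give equal counts, so mqs gets no name of its own.
#sqm #qms #qsm #smq #msq : ℕ → ℕ → ℕ
#sqm n = paths n sqm
#qms n = paths n qms
#qsm n = paths n qsm
#smq n = paths n smq
#msq n = paths n msq

-- Either state has two steps to `qms` without gain and two steps to `sqm` with gain 1; only the
-- insertions causing them differ.
#qsm-sym : ∀ n i → paths n mqs i ≡ #qsm n i
#qsm-sym zero    zero    = refl
#qsm-sym zero    (suc i) = refl
#qsm-sym (suc n) zero    = sym (+-identityʳ (#qms n 0 + #qms n 0))
#qsm-sym (suc n) (suc i) = lemma (#sqm n i) (#qms n (suc i))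
  where
  lemma : ∀ e j → (e + j) + (e + j) ≡ (j + j) + (e + e)
  lemma = solve-∀

#sqm-suc : ∀ n i → #sqm (suc n) i ≡ #sqm n i + 2 * #qsm n i + #smq n i
#sqm-suc n i = trans (cong (λ x → (x + #smq n i) + (#sqm n i + #qsm n i)) (#qsm-sym n i)) (lemma (#sqm n i) (#qsm n i) (#smq n i))
  where
  lemma : ∀ e a d → (a + d) + (e + a) ≡ e + 2 * a + d
  lemma = solve-∀

#msq-suc : ∀ n i → #msq (suc n) i ≡ 4 * #smq n i
#msq-suc n i = lemma (#smq n i)
  where
  lemma : ∀ d → (d + d) + (d + d) ≡ 4 * d
  lemma = solve-∀

#smq-suc : ∀ n i → #smq (suc n) (suc i) ≡ 2 * #msq n i + 2 * #smq n (suc i)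
#smq-suc n i = lemma (#msq n i) (#smq n (suc i))
  where
  lemma : ∀ f d → (f + d) + (d + f) ≡ 2 * f + 2 * d
  lemma = solve-∀

-- All four steps from `msq` lead to `smq` without gain, so `msq` can be eliminated and `smq`
-- satisfies a recurrence by itself.
#smq-suc-suc : ∀ n i → #smq (suc (suc n)) (suc i) ≡ 8 * #smq n i + 2 * #smq (suc n) (suc i)
#smq-suc-suc n i = trans (#smq-suc (suc n) i)
  (cong (_+ 2 * #smq (suc n) (suc i)) (trans (cong (2 *_) (#msq-suc n i)) (sym (*-assoc 2 4 (#smq n i)))))

#smq-zero : ∀ n → #smq n 0 ≡ 2 ^ n
#smq-zero zero    = refl
#smq-zero (suc n) = trans (lemma (#smq n 0)) (cong (2 *_) (#smq-zero n))
  where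
  lemma : ∀ d → (0 + d) + (d + 0) ≡ 2 * d
  lemma = solve-∀

#qsm-suc : ∀ n i → #qsm (suc n) (suc i) ≡ 2 * #sqm n i + 2 * #qms n (suc i)
#qsm-suc n i = lemma (#sqm n i) (#qms n (suc i))
  where
  lemma : ∀ e j → (j + j) + (e + e) ≡ 2 * e + 2 * j
  lemma = solve-∀

#qms-suc : ∀ n i → #qms (suc n) (suc i) ≡ 2 * #qsm n i + #smq n i + #qms n (suc i)
#qms-suc n i = trans (cong (λ x → (#qsm n i + #qms n (suc i)) + (#smq n i + x)) (#qsm-sym n i)) (lemma (#qsm n i) (#smq n i) (#qms n (suc i)))
  where
  lemma : ∀ a d j → (a + j) + (d + a) ≡ 2 * a + d + j
  lemma = solve-∀

#qms-zero : ∀ n → #qms n 0 ≡ 1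
#qms-zero zero    = refl
#qms-zero (suc n) = trans (+-identityʳ (#qms n 0)) (#qms-zero n)

-- By `#qms-suc` and `#sqm-suc`, the count from `qms` at genus i + 1 and that from `sqm` at genus i
-- have the same increments in `n`. Their difference is thus the one at n = 0: it is 1 for i = 0 and
-- 0 in `#qms-suc-suc`.
#qms-one : ∀ n → suc (#qms n 1) ≡ #sqm n 0
#qms-one zero    = refl
#qms-one (suc n) = begin
  suc (#qms (suc n) 1)                    ≡⟨ cong suc (#qms-suc n 0) ⟩
  suc (2 * #qsm n 0 + #smq n 0 + #qms n 1)      ≡⟨ lemma (#qsm n 0) (#smq n 0) (#qms n 1) ⟩
  suc (#qms n 1) + 2 * #qsm n 0 + #smq n 0      ≡⟨ cong (λ e → e + 2 * #qsm n 0 + #smq n 0) (#qms-one n) ⟩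
  #sqm n 0 + 2 * #qsm n 0 + #smq n 0            ≡⟨ #sqm-suc n 0 ⟨
  #sqm (suc n) 0                          ∎
  where
  open ≡-Reasoning
  lemma : ∀ a d j → suc (2 * a + d + j) ≡ suc j + 2 * a + d
  lemma = solve-∀

#qms-suc-suc : ∀ n i → #qms n (suc (suc i)) ≡ #sqm n (suc i)
#qms-suc-suc zero    i = refl
#qms-suc-suc (suc n) i = begin
  #qms (suc n) (2 + i)                                    ≡⟨ #qms-suc n (suc i) ⟩
  2 * #qsm n (suc i) + #smq n (suc i) + #qms n (2 + i)
    ≡⟨ cong (2 * #qsm n (suc i) + #smq n (suc i) +_) (#qms-suc-suc n i) ⟩
  2 * #qsm n (suc i) + #smq n (suc i) + #sqm n (suc i)
    ≡⟨ lemma (#qsm n (suc i)) (#smq n (suc i)) (#sqm n (suc i)) ⟩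
  #sqm n (suc i) + 2 * #qsm n (suc i) + #smq n (suc i)          ≡⟨ #sqm-suc n (suc i) ⟨
  #sqm (suc n) (suc i)                                    ∎
  where
  open ≡-Reasoning
  lemma : ∀ a d e → 2 * a + d + e ≡ e + 2 * a + d
  lemma = solve-∀

#sqm-suc-suc-2+ : ∀ n i → #sqm (2 + n) (2 + i) ≡ #sqm (1 + n) (2 + i) + 8 * #sqm n (1 + i) + #smq (1 + n) (2 + i)
#sqm-suc-suc-2+ n i = begin
  #sqm (2 + n) (2 + i)
    ≡⟨ #sqm-suc (suc n) (2 + i) ⟩
  e + 2 * #qsm (suc n) (2 + i) + d
    ≡⟨ cong (λ x → e + 2 * x + d) (#qsm-suc n (suc i)) ⟩
  e + 2 * (2 * #sqm n (suc i) + 2 * #qms n (2 + i)) + d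
    ≡⟨ cong (λ x → e + 2 * (2 * #sqm n (suc i) + 2 * x) + d) (#qms-suc-suc n i) ⟩
  e + 2 * (2 * #sqm n (suc i) + 2 * #sqm n (suc i)) + d
    ≡⟨ lemma e (#sqm n (suc i)) d ⟩
  e + 8 * #sqm n (suc i) + d                                                        ∎
  where
  open ≡-Reasoning
  e = #sqm (suc n) (2 + i)
  d = #smq (suc n) (2 + i)
  lemma : ∀ e x d → e + 2 * (2 * x + 2 * x) + d ≡ e + 8 * x + d
  lemma = solve-∀

-- The 4 is the unit of `#qms-one`, multiplied by 2 in `#qsm-suc` and by 2 again in `#sqm-suc`.
#sqm-suc-suc-1 : ∀ n → #sqm (2 + n) 1 + 4 ≡ #sqm (1 + n) 1 + 8 * #sqm n 0 + #smq (1 + n) 1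
#sqm-suc-suc-1 n = begin
  #sqm (2 + n) 1 + 4                                           ≡⟨ cong (_+ 4) (#sqm-suc (suc n) 1) ⟩
  e + 2 * #qsm (suc n) 1 + d + 4
    ≡⟨ cong (λ x → e + 2 * x + d + 4) (#qsm-suc n 0) ⟩
  e + 2 * (2 * #sqm n 0 + 2 * #qms n 1) + d + 4                   ≡⟨ lemma e (#sqm n 0) (#qms n 1) d ⟩
  e + (4 * #sqm n 0 + 4 * suc (#qms n 1)) + d
    ≡⟨ cong (λ x → e + (4 * #sqm n 0 + 4 * x) + d) (#qms-one n) ⟩
  e + (4 * #sqm n 0 + 4 * #sqm n 0) + d                           ≡⟨ lemma′ e (#sqm n 0) d ⟩
  e + 8 * #sqm n 0 + d                                         ∎
  where
  open ≡-Reasoning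
  e = #sqm (suc n) 1
  d = #smq (suc n) 1
  lemma : ∀ e x j d → e + 2 * (2 * x + 2 * j) + d + 4 ≡ e + (4 * x + 4 * suc j) + d
  lemma = solve-∀
  lemma′ : ∀ e x d → e + (4 * x + 4 * x) + d ≡ e + 8 * x + d
  lemma′ = solve-∀

-- Closed forms

#smq-vanishes : ∀ n i → n < suc (i * 2) → #smq n (suc i) ≡ 0
#smq-vanishes zero          i       _ = refl
#smq-vanishes (suc zero)    zero    (s≤s ())
#smq-vanishes (suc zero)    (suc i) _ = refl
#smq-vanishes (suc (suc n)) zero    (s≤s ())
#smq-vanishes (suc (suc n)) (suc i) (s≤s (s≤s p)) = trans (#smq-suc-suc n (suc i))
  (cong₂ (λ x y → 8 * x + 2 * y) (#smq-vanishes n i p) (#smq-vanishes (suc n) (suc i) (s≤s (m≤n⇒m≤1+n p))))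

#sqm-vanishes : ∀ n i → n < suc (suc (i * 2)) → #sqm n (suc i) ≡ 0
#sqm-vanishes zero          i       _ = refl
#sqm-vanishes (suc zero)    zero    _ = refl
#sqm-vanishes (suc zero)    (suc i) _ = refl
#sqm-vanishes (suc (suc n)) zero    (s≤s (s≤s ()))
#sqm-vanishes (suc (suc n)) (suc i) (s≤s (s≤s p)) = trans (#sqm-suc-suc-2+ n i)
  (cong₂ _+_ (cong₂ (λ x y → x + 8 * y) (#sqm-vanishes (suc n) (suc i) (s≤s (m≤n⇒m≤1+n p))) (#sqm-vanishes n i p))
             (#smq-vanishes (suc n) (suc i) (s≤s p)))

-- L (1 + t) i is the Lucas-type number C(t+i, i) + C(t+i-1, i).
L : ℕ → ℕ → ℕ
L zero    i       = 0
L (suc t) zero    = first t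
  where
  first : ℕ → ℕ
  first zero    = 1
  first (suc _) = 2
L (suc t) (suc i) = L t (suc i) + L (suc t) i

-- In `#smq-suc-suc` the term with 8 lowers `i` and keeps `r`, the term with 2 lowers `r` and keeps
-- `i`. Dividing by the powers of 8 and 2 leaves the Pascal rule of `L`.
#smq-closed : ∀ i r → #smq (i * 2 + suc r) (suc i) ≡ 2 * (2 ^ r * 8 ^ i * L (suc r) (suc i))
#smq-closed zero    zero    = refl
#smq-closed zero    (suc r) = begin
  #smq (2 + r) 1                                     ≡⟨ #smq-suc-suc r 0 ⟩
  8 * #smq r 0 + 2 * #smq (1 + r) 1
    ≡⟨ cong₂ (λ x y → 8 * x + 2 * y) (#smq-zero r) (#smq-closed zero r) ⟩
  8 * x + 2 * (2 * (x * 1 * l))                   ≡⟨ lemma x l ⟩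
  2 * (2 * x * 1 * (l + 2))                       ∎
  where
  open ≡-Reasoning
  x = 2 ^ r
  l = L (suc r) 1
  lemma : ∀ x l → 8 * x + 2 * (2 * (x * 1 * l)) ≡ 2 * (2 * x * 1 * (l + 2))
  lemma = solve-∀
#smq-closed (suc i) zero    = begin
  #smq (2 + (i * 2 + 1)) (2 + i)                             ≡⟨ #smq-suc-suc (i * 2 + 1) (suc i) ⟩
  8 * #smq (i * 2 + 1) (suc i) + 2 * #smq (suc (i * 2 + 1)) (2 + i)
    ≡⟨ cong₂ (λ x y → 8 * x + 2 * y) (#smq-closed i zero) (#smq-vanishes (suc (i * 2 + 1)) (suc i) (≤-reflexive (cong (λ z → suc (suc z)) (+-comm (i * 2) 1)))) ⟩
  8 * (2 * (1 * x * l)) + 2 * 0                           ≡⟨ lemma x l ⟩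
  2 * (1 * (8 * x) * l)                                   ∎
  where
  open ≡-Reasoning
  x = 8 ^ i
  l = L 1 (suc i)
  lemma : ∀ x l → 8 * (2 * (1 * x * l)) + 2 * 0 ≡ 2 * (1 * (8 * x) * l)
  lemma = solve-∀
#smq-closed (suc i) (suc r) = begin
  #smq (2 + (i * 2 + suc (suc r))) (2 + i)
    ≡⟨ #smq-suc-suc (i * 2 + suc (suc r)) (suc i) ⟩
  8 * #smq (i * 2 + suc (suc r)) (suc i) + 2 * #smq (suc (i * 2 + suc (suc r))) (2 + i)
    ≡⟨ cong₂ (λ x y → 8 * x + 2 * y) (#smq-closed i (suc r)) (trans (cong (λ z → #smq (suc z) (2 + i)) (+-suc (i * 2) (suc r))) (#smq-closed (suc i) r)) ⟩
  8 * (2 * (2 * x * y * l)) + 2 * (2 * (x * (8 * y) * l′))           ≡⟨ lemma x y l l′ ⟩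
  2 * (2 * x * (8 * y) * (l′ + l))                                  ∎
  where
  open ≡-Reasoning
  x = 2 ^ r
  y = 8 ^ i
  l = L (suc (suc r)) (suc i)
  l′ = L (suc r) (suc (suc i))
  lemma : ∀ x y l l′ → 8 * (2 * (2 * x * y * l)) + 2 * (2 * (x * (8 * y) * l′)) ≡ 2 * (2 * x * (8 * y) * (l′ + l))
  lemma = solve-∀

#sqm-zero : ∀ n → #sqm n 0 ≡ 2 ^ n + 2 * L n 1
#sqm-zero zero          = refl
#sqm-zero (suc zero)    = refl
#sqm-zero (suc (suc n)) = begin
  #sqm (2 + n) 0                                       ≡⟨ #sqm-suc (suc n) 0 ⟩
  #sqm (1 + n) 0 + 2 * #qsm (1 + n) 0 + #smq (1 + n) 0
    ≡⟨ cong₂ _+_ (cong₂ (λ x y → x + 2 * y) (#sqm-zero (suc n)) #qsm-zero) (#smq-zero (suc n)) ⟩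
  x + 2 * l + 4 + x                                 ≡⟨ lemma x l ⟩
  2 * x + 2 * (l + 2)                               ∎
  where
  open ≡-Reasoning
  x = 2 ^ suc n
  l = L (suc n) 1
  #qsm-zero : #qsm (1 + n) 0 ≡ 2
  #qsm-zero rewrite #qms-zero n = refl
  lemma : ∀ x l → x + 2 * l + 4 + x ≡ 2 * x + 2 * (l + 2)
  lemma = solve-∀

-- The summand added on the left is the -1 of the closed form. In the recurrence one term lowers
-- `r`, another lowers `i`, as in the Pascal rule of `L`; the term from `smq` doubles the power of 2
-- wherever `r` was lowered.
#sqm-closed : ∀ i r → #sqm (suc i * 2 + r) (suc i) + 2 * (8 ^ i * L (2 + r) (suc i)) ≡
                   2 * (8 ^ i * (2 * 2 ^ r * L (2 + r) (suc i) + 8 * L r (2 + i)))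
#sqm-closed zero    zero    = refl
#sqm-closed zero    (suc r) = begin
  -- The added `L`-value grows by 2 with each letter, and this absorbs the 4 of `#sqm-suc-suc-1`.
  e + 2 * (1 * (l + 2))                                        ≡⟨ lemma₁ e l ⟩
  (e + 4) + 2 * l                                              ≡⟨ cong (_+ 2 * l) (#sqm-suc-suc-1 (suc r)) ⟩
  (e′ + 8 * #sqm (suc r) 0 + #smq (2 + r) 1) + 2 * l
    ≡⟨ cong₂ (λ x y → (e′ + 8 * x + y) + 2 * l) (#sqm-zero (suc r)) (#smq-closed zero (suc r)) ⟩
  (e′ + 8 * (2 * x + 2 * l₁) + 2 * (2 * x * 1 * l)) + 2 * l    ≡⟨ lemma₂ e′ x l l₁ ⟩
  (e′ + 2 * (1 * l)) + (8 * (2 * x + 2 * l₁) + 2 * (2 * x * 1 * l))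
    ≡⟨ cong (_+ (8 * (2 * x + 2 * l₁) + 2 * (2 * x * 1 * l))) (#sqm-closed zero r) ⟩
  2 * (1 * (2 * x * l + 8 * l₂)) + (8 * (2 * x + 2 * l₁) + 2 * (2 * x * 1 * l)) ≡⟨ lemma₃ x l l₁ l₂ ⟩
  2 * (1 * (2 * (2 * x) * (l + 2) + 8 * (l₂ + l₁)))            ∎
  where
  open ≡-Reasoning
  e = #sqm (3 + r) 1
  e′ = #sqm (2 + r) 1
  x = 2 ^ r
  l = L (2 + r) 1
  l₁ = L (suc r) 1
  l₂ = L r 2
  lemma₁ : ∀ e l → e + 2 * (1 * (l + 2)) ≡ (e + 4) + 2 * l
  lemma₁ = solve-∀
  lemma₂ : ∀ e x l l₁ → (e + 8 * (2 * x + 2 * l₁) + 2 * (2 * x * 1 * l)) + 2 * l ≡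
                        (e + 2 * (1 * l)) + (8 * (2 * x + 2 * l₁) + 2 * (2 * x * 1 * l))
  lemma₂ = solve-∀
  lemma₃ : ∀ x l l₁ l₂ → 2 * (1 * (2 * x * l + 8 * l₂)) + (8 * (2 * x + 2 * l₁) + 2 * (2 * x * 1 * l)) ≡
                         2 * (1 * (2 * (2 * x) * (l + 2) + 8 * (l₂ + l₁)))
  lemma₃ = solve-∀
#sqm-closed (suc i) zero    = begin
  #sqm (2 + n) (2 + i) + 2 * (8 * y * (l + l₂))
    ≡⟨ cong (_+ 2 * (8 * y * (l + l₂))) (#sqm-suc-suc-2+ n i) ⟩
  #sqm (1 + n) (2 + i) + 8 * #sqm n (1 + i) + #smq (1 + n) (2 + i) + 2 * (8 * y * (l + l₂))
    -- At r = 0 the first count vanishes: it would need one letter more for its genus.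
    ≡⟨ cong₂ (λ u v → u + 8 * #sqm n (1 + i) + v + 2 * (8 * y * (l + l₂)))
         (#sqm-vanishes (1 + n) (suc i) (≤-reflexive (cong (λ z → 4 + z) (+-identityʳ (i * 2)))))
         (trans (cong (λ z → #smq z (2 + i)) (sym (+-suc (suc i * 2) 0))) (#smq-closed (suc i) zero)) ⟩
  0 + 8 * #sqm n (1 + i) + 2 * (1 * (8 * y) * l) + 2 * (8 * y * (l + l₂)) ≡⟨ lemma₁ (#sqm n (1 + i)) y l l₂ ⟩
  8 * (#sqm n (1 + i) + 2 * (y * l₂)) + 32 * (y * l)
    ≡⟨ cong (λ z → 8 * z + 32 * (y * l)) (#sqm-closed i zero) ⟩
  8 * (2 * (y * (2 * 1 * l₂ + 8 * 0))) + 32 * (y * l)                  ≡⟨ lemma₂ y l l₂ ⟩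
  2 * (8 * y * (2 * 1 * (l + l₂) + 8 * 0))                            ∎
  where
  open ≡-Reasoning
  n = suc i * 2 + 0
  y = 8 ^ i
  l = L 1 (2 + i)
  l₂ = L 2 (1 + i)
  lemma₁ : ∀ e y l l₂ → 0 + 8 * e + 2 * (1 * (8 * y) * l) + 2 * (8 * y * (l + l₂)) ≡ 8 * (e + 2 * (y * l₂)) + 32 * (y * l)
  lemma₁ = solve-∀
  lemma₂ : ∀ y l l₂ → 8 * (2 * (y * (2 * 1 * l₂ + 8 * 0))) + 32 * (y * l) ≡ 2 * (8 * y * (2 * 1 * (l + l₂) + 8 * 0))
  lemma₂ = solve-∀
#sqm-closed (suc i) (suc r) = begin
  #sqm (2 + n) (2 + i) + 2 * (8 * y * (l₂ + l₃))
    ≡⟨ cong (_+ 2 * (8 * y * (l₂ + l₃))) (#sqm-suc-suc-2+ n i) ⟩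
  #sqm (1 + n) (2 + i) + 8 * #sqm n (1 + i) + #smq (1 + n) (2 + i) + 2 * (8 * y * (l₂ + l₃))
    ≡⟨ cong₂ (λ u v → u + 8 * #sqm n (1 + i) + v + 2 * (8 * y * (l₂ + l₃)))
         (cong (λ z → #sqm (suc z) (2 + i)) (+-suc (suc i * 2) r))
         (trans (cong (λ z → #smq z (2 + i)) (sym (+-suc (suc i * 2) (suc r)))) (#smq-closed (suc i) (suc r))) ⟩
  e + 8 * #sqm n (1 + i) + 2 * (2 * x * (8 * y) * l₂) + 2 * (8 * y * (l₂ + l₃))
    ≡⟨ lemma₁ e (#sqm n (1 + i)) x y l₂ l₃ ⟩
  (e + 2 * (8 * y * l₂)) + 8 * (#sqm n (1 + i) + 2 * (y * l₃)) + 2 * (2 * x * (8 * y) * l₂)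
    ≡⟨ cong₂ (λ u v → u + 8 * v + 2 * (2 * x * (8 * y) * l₂)) (#sqm-closed (suc i) r) (#sqm-closed i (suc r)) ⟩
  2 * (8 * y * (2 * x * l₂ + 8 * l₀)) + 8 * (2 * (y * (2 * (2 * x) * l₃ + 8 * l₁))) + 2 * (2 * x * (8 * y) * l₂)
    ≡⟨ lemma₂ x y l₀ l₁ l₂ l₃ ⟩
  2 * (8 * y * (2 * (2 * x) * (l₂ + l₃) + 8 * (l₀ + l₁)))        ∎
  where
  open ≡-Reasoning
  n = suc i * 2 + suc r
  e = #sqm (suc (suc i) * 2 + r) (2 + i)
  x = 2 ^ r
  y = 8 ^ i
  l₀ = L r (3 + i)
  l₁ = L (1 + r) (2 + i)
  l₂ = L (2 + r) (2 + i)
  l₃ = L (3 + r) (1 + i)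
  lemma₁ : ∀ e e′ x y l₂ l₃ → e + 8 * e′ + 2 * (2 * x * (8 * y) * l₂) + 2 * (8 * y * (l₂ + l₃)) ≡
           (e + 2 * (8 * y * l₂)) + 8 * (e′ + 2 * (y * l₃)) + 2 * (2 * x * (8 * y) * l₂)
  lemma₁ = solve-∀
  lemma₂ : ∀ x y l₀ l₁ l₂ l₃ →
           2 * (8 * y * (2 * x * l₂ + 8 * l₀)) + 8 * (2 * (y * (2 * (2 * x) * l₃ + 8 * l₁))) + 2 * (2 * x * (8 * y) * l₂) ≡
           2 * (8 * y * (2 * (2 * x) * (l₂ + l₃) + 8 * (l₀ + l₁)))
  lemma₂ = solve-∀

-- Comparison of consecutive terms

L-first : ∀ i → L 1 i ≡ 1
L-first zero    = refl
L-first (suc i) = L-first i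

L-one : ∀ t → L (suc t) 1 ≡ 2 * t + 1
L-one zero    = refl
L-one (suc t) = trans (cong (_+ 2) (L-one t)) (lemma t)
  where
  lemma : ∀ t → 2 * t + 1 + 2 ≡ 2 * suc t + 1
  lemma = solve-∀

L-positive : ∀ t i → 0 < L (suc t) i
L-positive zero    i       = ≤-reflexive (sym (L-first i))
L-positive (suc t) zero    = s≤s z≤n
L-positive (suc t) (suc i) = ≤-trans (L-positive (suc t) i) (m≤n+m _ (L (suc t) (suc i)))

-- The sum C(t+i+1, i+1) + C(t+i, i+1) over the common denominator (i+1)! t!, whose numerator has
-- the factor (t+i+1) + t.
L-factorial : ∀ t i → L (suc t) (suc i) * (suc i ! * t !) ≡ (2 * t + 1 + i) * (t + i) !
L-factorial zero    i       = trans (cong (_* (suc i ! * 1)) (L-first (suc i))) (lemma i (i !))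
  where
  lemma : ∀ i f → 1 * ((f + i * f) * 1) ≡ suc i * f
  lemma = solve-∀
L-factorial (suc t) zero    = begin
  L (2 + t) 1 * (1 * suc t !)              ≡⟨ cong₂ _*_ (L-one (suc t)) (*-identityˡ (suc t !)) ⟩
  (2 * suc t + 1) * suc t !
    ≡⟨ cong₂ (λ x y → x * y !) (sym (+-identityʳ (2 * suc t + 1))) (sym (+-identityʳ (suc t))) ⟩
  (2 * suc t + 1 + 0) * (suc t + 0) !      ∎
  where open ≡-Reasoning
L-factorial (suc t) (suc i) = begin
  (l + l′) * ((2 + i) * F * (suc t * G))                               ≡⟨ split l l′ t i F G ⟩
  suc t * (l * ((2 + i) * F * G)) + (2 + i) * (l′ * (F * (suc t * G)))
    ≡⟨ cong₂ (λ x y → suc t * x + (2 + i) * y) (L-factorial t (suc i)) (L-factorial (suc t) i) ⟩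
  suc t * ((2 * t + 1 + suc i) * (t + suc i) !) + (2 + i) * ((2 * suc t + 1 + i) * H)
    ≡⟨ cong (λ z → suc t * ((2 * t + 1 + suc i) * z !) + (2 + i) * ((2 * suc t + 1 + i) * H)) (+-suc t i) ⟩
  suc t * ((2 * t + 1 + suc i) * H) + (2 + i) * ((2 * suc t + 1 + i) * H) ≡⟨ collect t i H ⟩
  (2 * suc t + 1 + suc i) * ((2 + (t + i)) * H)
    ≡⟨ cong (λ z → (2 * suc t + 1 + suc i) * z !) (cong suc (sym (+-suc t i))) ⟩
  (2 * suc t + 1 + suc i) * (suc t + suc i) !                           ∎
  where
  open ≡-Reasoning
  l  = L (suc t) (2 + i)
  l′ = L (2 + t) (suc i)
  F = suc i !
  G = t !
  H = suc (t + i) !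
  split : ∀ l l′ t i F G → (l + l′) * ((2 + i) * F * (suc t * G)) ≡
          suc t * (l * ((2 + i) * F * G)) + (2 + i) * (l′ * (F * (suc t * G)))
  split = solve-∀
  collect : ∀ t i H → suc t * ((2 * t + 1 + suc i) * H) + (2 + i) * ((2 * suc t + 1 + i) * H) ≡
            (2 * suc t + 1 + suc i) * ((2 + (t + i)) * H)
  collect = solve-∀

-- The quotient of two product formulas. The indices move along this diagonal because, for fixed n,
-- raising the genus by one lowers s by two.
L-diagonal : ∀ t i → L (1 + t) (2 + i) * ((2 + i) * (2 + t + i) * (5 + 2 * t + i)) ≡
                     L (3 + t) (1 + i) * ((2 + t) * (1 + t) * (2 + 2 * t + i))
L-diagonal t i = *-cancelʳ-≡ _ _ (F * G) {{m*n≢0 F G {{suc i !≢0}} {{t !≢0}}}} (begin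
  b * ((2 + i) * (2 + t + i) * (5 + 2 * t + i)) * (F * G)       ≡⟨ lemma₁ b t i F G ⟩
  b * ((2 + i) * F * G) * ((2 + t + i) * (5 + 2 * t + i))
    ≡⟨ cong (_* ((2 + t + i) * (5 + 2 * t + i))) (L-factorial t (suc i)) ⟩
  (2 * t + 1 + suc i) * (t + suc i) ! * ((2 + t + i) * (5 + 2 * t + i))
    ≡⟨ cong (λ z → (2 * t + 1 + suc i) * z ! * ((2 + t + i) * (5 + 2 * t + i))) (+-suc t i) ⟩
  (2 * t + 1 + suc i) * H * ((2 + t + i) * (5 + 2 * t + i))      ≡⟨ lemma₂ t i H ⟩
  (2 * (2 + t) + 1 + i) * ((2 + t + i) * H) * (2 + 2 * t + i)
    ≡⟨ cong (_* (2 + 2 * t + i)) (L-factorial (2 + t) i) ⟨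
  c * (F * ((2 + t) * ((1 + t) * G))) * (2 + 2 * t + i)          ≡⟨ lemma₃ c t i F G ⟩
  c * ((2 + t) * (1 + t) * (2 + 2 * t + i)) * (F * G)            ∎)
  where
  open ≡-Reasoning
  b = L (1 + t) (2 + i)
  c = L (3 + t) (1 + i)
  F = suc i !
  G = t !
  H = suc (t + i) !
  lemma₁ : ∀ b t i F G → b * ((2 + i) * (2 + t + i) * (5 + 2 * t + i)) * (F * G) ≡
           b * ((2 + i) * F * G) * ((2 + t + i) * (5 + 2 * t + i))
  lemma₁ = solve-∀
  lemma₂ : ∀ t i H → (2 * t + 1 + suc i) * H * ((2 + t + i) * (5 + 2 * t + i)) ≡
           (2 * (2 + t) + 1 + i) * ((2 + t + i) * H) * (2 + 2 * t + i)
  lemma₂ = solve-∀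
  lemma₃ : ∀ c t i F G → c * (F * ((2 + t) * ((1 + t) * G))) * (2 + 2 * t + i) ≡
           c * ((2 + t) * (1 + t) * (2 + 2 * t + i)) * (F * G)
  lemma₃ = solve-∀

module _ (i r : ℕ) where
  private
    n = suc (suc i) * 2 + r
    x = 2 ^ r
    y = 8 ^ i
    a = L (4 + r) (1 + i)
    b = L (2 + r) (2 + i)
    c = L r (3 + i)
    W = 8 * x

  -- Each of the two closed forms has one term on the wrong side. Adding both terms to both counts
  -- brings them to a common shape with the common factor 2 y, where `W` is the power of 2 with
  -- exponent s + 1 belonging to the lower genus.
  scaled-lower : #sqm n (1 + i) + (2 * (y * a) + 16 * (y * b)) ≡ 2 * (y * (W * a + 16 * b))
  scaled-lower = begin
    #sqm n (1 + i) + (2 * (y * a) + 16 * (y * b))               ≡⟨ +-assoc (#sqm n (1 + i)) _ _ ⟨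
    #sqm n (1 + i) + 2 * (y * a) + 16 * (y * b)
      ≡⟨ cong (λ z → #sqm z (1 + i) + 2 * (y * a) + 16 * (y * b)) (sym (trans (+-suc (suc i * 2) (suc r)) (cong suc (+-suc (suc i * 2) r)))) ⟩
    #sqm (suc i * 2 + (2 + r)) (1 + i) + 2 * (y * a) + 16 * (y * b)
      ≡⟨ cong (_+ 16 * (y * b)) (#sqm-closed i (2 + r)) ⟩
    2 * (y * (2 * (2 * (2 * x)) * a + 8 * b)) + 16 * (y * b) ≡⟨ lemma x y a b ⟩
    2 * (y * (W * a + 16 * b))                               ∎
    where
    open ≡-Reasoning
    lemma : ∀ x y a b → 2 * (y * (2 * (2 * (2 * x)) * a + 8 * b)) + 16 * (y * b) ≡ 2 * (y * (8 * x * a + 16 * b))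
    lemma = solve-∀

  scaled-upper : #sqm n (2 + i) + (2 * (y * a) + 16 * (y * b)) ≡ 2 * (y * (2 * W * b + 64 * c + a))
  scaled-upper = begin
    #sqm n (2 + i) + (2 * (y * a) + 16 * (y * b))               ≡⟨ lemma₁ (#sqm n (2 + i)) y a b ⟩
    #sqm n (2 + i) + 2 * (8 * y * b) + 2 * (y * a)
      ≡⟨ cong (_+ 2 * (y * a)) (#sqm-closed (suc i) r) ⟩
    2 * (8 * y * (2 * x * b + 8 * c)) + 2 * (y * a)          ≡⟨ lemma₂ x y a b c ⟩
    2 * (y * (2 * W * b + 64 * c + a))                       ∎
    where
    open ≡-Reasoning
    lemma₁ : ∀ e y a b → e + (2 * (y * a) + 16 * (y * b)) ≡ e + 2 * (8 * y * b) + 2 * (y * a)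
    lemma₁ = solve-∀
    lemma₂ : ∀ x y a b c → 2 * (8 * y * (2 * x * b + 8 * c)) + 2 * (y * a) ≡ 2 * (y * (2 * (8 * x) * b + 64 * c + a))
    lemma₂ = solve-∀

  private instance
    y≢0 : NonZero y
    y≢0 = m^n≢0 8 i

  step-rises : W * a + 16 * b < 2 * W * b + 64 * c + a → #sqm n (1 + i) < #sqm n (2 + i)
  step-rises p = +-cancelʳ-< (2 * (y * a) + 16 * (y * b)) _ _ (≤-<-trans (≤-reflexive scaled-lower)
    (<-≤-trans (*-monoʳ-< 2 (*-monoʳ-< y p)) (≤-reflexive (sym scaled-upper))))

  step-falls : 2 * W * b + 64 * c + a < W * a + 16 * b → #sqm n (2 + i) < #sqm n (1 + i)
  step-falls p = +-cancelʳ-< (2 * (y * a) + 16 * (y * b)) _ _ (≤-<-trans (≤-reflexive scaled-upper)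
    (<-≤-trans (*-monoʳ-< 2 (*-monoʳ-< y p)) (≤-reflexive (sym scaled-lower))))

-- The rising part

suc≤2^ : ∀ k → suc k ≤ 2 ^ k
suc≤2^ zero    = ≤-refl
suc≤2^ (suc k) = ≤-trans (s≤s (m≤m+n (suc k) _)) (≤-trans (≤-reflexive (lemma k)) (*-monoʳ-≤ 2 (suc≤2^ k)))
  where
  lemma : ∀ k → suc (suc k + k) ≡ 2 * suc k
  lemma = solve-∀

+≡⇒≤ : ∀ m {n o} → m + n ≡ o → m ≤ o
+≡⇒≤ m {n} e = subst (m ≤_) e (m≤m+n m n)

-- Equality holds at exponent 5, which fixes the threshold between `rises-large` and `rises-small`.
4*≤2^ : ∀ k → 4 * (3 + (5 + k)) ≤ 2 ^ (5 + k)
4*≤2^ zero    = ≤-refl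
4*≤2^ (suc k) = begin
  4 * (3 + (5 + suc k))              ≤⟨ m≤m+n _ (4 * (7 + k)) ⟩
  4 * (3 + (5 + suc k)) + 4 * (7 + k) ≡⟨ lemma k ⟩
  2 * (4 * (3 + (5 + k)))            ≤⟨ *-monoʳ-≤ 2 (4*≤2^ k) ⟩
  2 * 2 ^ (5 + k)                    ∎
  where
  open ≤-Reasoning
  lemma : ∀ k → 4 * (3 + (5 + suc k)) + 4 * (7 + k) ≡ 2 * (4 * (3 + (5 + k)))
  lemma = solve-∀

-- For the two L-values a, b, where b Y = a X by L-diagonal, this is
-- W (2 X - Y) ≥ 16 X.
rises-from : ∀ W a b X Y u .{{_ : NonZero X}} .{{_ : NonZero u}} → b * Y ≡ a * X → 2 * u * Y + X ≤ 2 * u * (2 * X) →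
             8 * (4 * u) ≤ W → W * a + 16 * b ≤ 2 * W * b
rises-from W a b X Y u bY≡aX margin W-large = *-cancelʳ-≤ _ _ X (begin
  (W * a + 16 * b) * X            ≡⟨ lemma₁ W a b X ⟩
  W * (a * X) + 16 * b * X        ≡⟨ cong (λ z → W * z + 16 * b * X) bY≡aX ⟨
  W * (b * Y) + 16 * b * X        ≡⟨ lemma₂ W b X Y ⟩
  b * (W * Y + 16 * X)            ≤⟨ *-monoʳ-≤ b (bound W W-large) ⟩
  b * (2 * W * X)                 ≡⟨ lemma₃ W b X ⟩
  2 * W * b * X                   ∎)
  where
  open ≤-Reasoning
  Y≤2X : Y ≤ 2 * X
  Y≤2X = *-cancelˡ-≤ (2 * u) {{m*n≢0 2 u}} (≤-trans (m≤m+n (2 * u * Y) X) margin)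
  lemma₁ : ∀ W a b X → (W * a + 16 * b) * X ≡ W * (a * X) + 16 * b * X
  lemma₁ = solve-∀
  lemma₂ : ∀ W b X Y → W * (b * Y) + 16 * b * X ≡ b * (W * Y + 16 * X)
  lemma₂ = solve-∀
  lemma₃ : ∀ W b X → b * (2 * W * X) ≡ 2 * W * b * X
  lemma₃ = solve-∀
  lemma₄ : ∀ u w X Y → (8 * (4 * u) + w) * Y + 16 * X ≡ 16 * (2 * u * Y + X) + w * Y
  lemma₄ = solve-∀
  lemma₅ : ∀ u w X → 16 * (2 * u * (2 * X)) + w * (2 * X) ≡ 2 * (8 * (4 * u) + w) * X
  lemma₅ = solve-∀
  bound : ∀ W → 8 * (4 * u) ≤ W → W * Y + 16 * X ≤ 2 * W * X
  bound W W-large with w , refl ← m≤n⇒∃[o]m+o≡n W-large = begin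
    (8 * (4 * u) + w) * Y + 16 * X          ≡⟨ lemma₄ u w X Y ⟩
    16 * (2 * u * Y + X) + w * Y            ≤⟨ +-mono-≤ (*-monoʳ-≤ 16 margin) (*-monoʳ-≤ w Y≤2X) ⟩
    16 * (2 * u * (2 * X)) + w * (2 * X)    ≡⟨ lemma₅ u w X ⟩
    2 * (8 * (4 * u) + w) * X               ∎

-- Writing r = i + j encodes i ≤ r. Then 2X - Y is at least X / (2 (3 + r)): in `gap` the difference
-- of the two sides is a polynomial in i and j with positive coefficients.
rises-large : ∀ i j → 5 ≤ i + j → let r = i + j ; W = 8 * 2 ^ r in
              W * L (4 + r) (1 + i) + 16 * L (2 + r) (2 + i) ≤ 2 * W * L (2 + r) (2 + i)
rises-large i j 5≤r = rises-from (8 * 2 ^ r) (L (4 + r) (1 + i)) (L (2 + r) (2 + i)) _ _ (3 + r)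
  (L-diagonal (suc r) i) margin W-large
  where
  r = i + j

  gap : ∀ i j → let r = i + j in
        2 * (3 + r) * ((2 + i) * (2 + suc r + i) * (5 + 2 * suc r + i)) + (2 + suc r) * (1 + suc r) * (2 + 2 * suc r + i) +
        (18 * (i * i * i * j) + 3 * (i * i * i) + 42 * (i * i * j * j) + 130 * (i * i * j) + 17 * (i * i) + 32 * (i * j * j * j)
          + 191 * (i * j * j) + 295 * (i * j) + 28 * i + 8 * (j * j * j * j) + 70 * (j * j * j) + 206 * (j * j) + 208 * j + 12)
        ≡ 2 * (3 + r) * (2 * ((2 + suc r) * (1 + suc r) * (2 + 2 * suc r + i)))
  gap = solve-∀

  margin : 2 * (3 + r) * ((2 + i) * (2 + suc r + i) * (5 + 2 * suc r + i)) + (2 + suc r) * (1 + suc r) * (2 + 2 * suc r + i)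
           ≤ 2 * (3 + r) * (2 * ((2 + suc r) * (1 + suc r) * (2 + 2 * suc r + i)))
  margin = +≡⇒≤ _ (gap i j)

  W-large : 8 * (4 * (3 + r)) ≤ 8 * 2 ^ r
  W-large with k , e ← m≤n⇒∃[o]m+o≡n 5≤r = *-monoʳ-≤ 8 (subst (λ r → 4 * (3 + r) ≤ 2 ^ r) e (4*≤2^ k))

by-evaluation : ∀ {m n} {_ : T (m <ᵇ n)} → m < n
by-evaluation {m} {n} {p} = <ᵇ⇒< m n p

-- The excluded pairs (0, 0) and (1, 0) are the exceptions (n, genus) = (4, 1) and (7, 2). At (2, 0)
-- the inequality reads 3712 < 3739, so the terms 64 c + a that `rises-large` gives away are
-- indispensable here.
rises-small : ∀ i j → i + j < 5 → 1 ≤ j ⊎ 2 ≤ i → let r = i + j ; W = 8 * 2 ^ r in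
              W * L (4 + r) (1 + i) + 16 * L (2 + r) (2 + i) < 2 * W * L (2 + r) (2 + i) + 64 * L r (3 + i) + L (4 + r) (1 + i)
rises-small 0 0 _ (inj₁ ())
rises-small 0 0 _ (inj₂ ())
rises-small 1 0 _ (inj₁ ())
rises-small 1 0 _ (inj₂ (s≤s ()))
rises-small 0 1 _ _ = by-evaluation
rises-small 0 2 _ _ = by-evaluation
rises-small 0 3 _ _ = by-evaluation
rises-small 0 4 _ _ = by-evaluation
rises-small 1 1 _ _ = by-evaluation
rises-small 1 2 _ _ = by-evaluation
rises-small 1 3 _ _ = by-evaluation
rises-small 2 0 _ _ = by-evaluation
rises-small 2 1 _ _ = by-evaluation
rises-small 2 2 _ _ = by-evaluation
rises-small 3 0 _ _ = by-evaluation
rises-small 3 1 _ _ = by-evaluation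
rises-small 4 0 _ _ = by-evaluation
rises-small 0 (suc (suc (suc (suc (suc _))))) (s≤s (s≤s (s≤s (s≤s (s≤s ()))))) _
rises-small 1 (suc (suc (suc (suc _)))) (s≤s (s≤s (s≤s (s≤s (s≤s ()))))) _
rises-small 2 (suc (suc (suc _))) (s≤s (s≤s (s≤s (s≤s (s≤s ()))))) _
rises-small 3 (suc (suc _)) (s≤s (s≤s (s≤s (s≤s (s≤s ()))))) _
rises-small 4 (suc _) (s≤s (s≤s (s≤s (s≤s (s≤s ()))))) _
rises-small (suc (suc (suc (suc (suc _))))) _ (s≤s (s≤s (s≤s (s≤s (s≤s ()))))) _

rises : ∀ i j → 1 ≤ j ⊎ 2 ≤ i → let r = i + j ; W = 8 * 2 ^ r in
        W * L (4 + r) (1 + i) + 16 * L (2 + r) (2 + i) < 2 * W * L (2 + r) (2 + i) + 64 * L r (3 + i) + L (4 + r) (1 + i)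
rises i j ok with 5 ≤? i + j
... | no 5≰r  = rises-small i j (≰⇒> 5≰r) ok
... | yes 5≤r = ≤-<-trans (≤-trans (rises-large i j 5≤r) (m≤m+n _ (64 * L (i + j) (3 + i))))
                  (m<m+n _ (L-positive (3 + (i + j)) (1 + i)))

-- The falling part

ratio-bound : ∀ a b X Y u v .{{_ : NonZero X}} → b * Y ≡ a * X → 2 * v * X ≤ u * Y → 2 * b * v ≤ a * u
ratio-bound a b X Y u v bY≡aX h = *-cancelʳ-≤ _ _ X (begin
  2 * b * v * X     ≡⟨ lemma₁ b v X ⟩
  b * (2 * v * X)   ≤⟨ *-monoʳ-≤ b h ⟩
  b * (u * Y)       ≡⟨ lemma₂ b u Y ⟩
  u * (b * Y)       ≡⟨ cong (u *_) bY≡aX ⟩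
  u * (a * X)       ≡⟨ lemma₃ a u X ⟩
  a * u * X         ∎)
  where
  open ≤-Reasoning
  lemma₁ : ∀ b v X → 2 * b * v * X ≡ b * (2 * v * X)
  lemma₁ = solve-∀
  lemma₂ : ∀ b u Y → b * (u * Y) ≡ u * (b * Y)
  lemma₂ = solve-∀
  lemma₃ : ∀ a u X → u * (a * X) ≡ a * u * X
  lemma₃ = solve-∀

-- On the falling side i exceeds r, and 2b/a stays below 1 by at least 1/(3 + r). This margin
-- becomes the lower bound for δ = a - 2b in `falls-from`.
falls-b≤a : ∀ r j → let i = suc r + j in
            2 * L (2 + r) (2 + i) * (3 + r) ≤ L (4 + r) (1 + i) * (2 + r)
falls-b≤a r j = ratio-bound (L (4 + r) (1 + i)) (L (2 + r) (2 + i)) _ _ (2 + r) (3 + r)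
  (L-diagonal (suc r) i) (+≡⇒≤ _ (gap r j))
  where
  i = suc r + j
  gap : ∀ r j → let i = suc r + j in
        2 * (3 + r) * ((2 + suc r) * (1 + suc r) * (2 + 2 * suc r + i)) +
        (2 + r) * (9 * (r * r * j) + 2 * r + 43 * (r * j) + 6 * (r * j * j) + 6 + 50 * j + 15 * (j * j) + j * j * j)
        ≡ (2 + r) * ((2 + i) * (2 + suc r + i) * (5 + 2 * suc r + i))
  gap = solve-∀

falls-c≤b : ∀ r j → let i = suc r + j in
            2 * L r (3 + i) * (4 + r) ≤ L (2 + r) (2 + i) * r
-- The third `L`-value is 0 at r = 0, in agreement with the factor r in the bound.
falls-c≤b zero    j = z≤n
falls-c≤b (suc t) j = ratio-bound (L (3 + t) (2 + i)) (L (1 + t) (3 + i)) _ _ (suc t) (5 + t)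
  (L-diagonal t (suc i)) (+≡⇒≤ _ (gap t j))
  where
  i = suc (suc t) + j
  gap : ∀ t j → let i = suc (suc t) + j in
        2 * (5 + t) * ((2 + t) * (1 + t) * (2 + 2 * t + suc i)) + suc t * (9 * (t * t) + 9 * (t * t * j) + 65 * t + 55 * (t * j) + 6 * (t * j * j) + 100 + 85 * j + 18 * (j * j) + j * j * j)
        ≡ suc t * ((2 + suc i) * (2 + t + suc i) * (5 + 2 * t + suc i))
  gap = solve-∀

-- The hypothesis bounds 64 c by b times 32 r / (4 + r), and this factor is below 14 for r = 0, 1,
-- 2.
64c<14b : ∀ r b c → r < 3 → 0 < b → 2 * c * (4 + r) ≤ b * r → 64 * c < 14 * b
64c<14b r b c r<3 0<b p = *-cancelʳ-< (4 + r) _ _ (begin-strict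
  64 * c * (4 + r)         ≡⟨ lemma c (4 + r) ⟩
  32 * (2 * c * (4 + r))   ≤⟨ *-monoʳ-≤ 32 p ⟩
  32 * (b * r)             ≡⟨ lemma′ b r ⟩
  b * (32 * r)             <⟨ *-monoʳ-< b {{>-nonZero 0<b}} (bound r r<3) ⟩
  b * (14 * (4 + r))       ≡⟨ lemma″ b (4 + r) ⟩
  14 * b * (4 + r)         ∎)
  where
  open ≤-Reasoning
  lemma : ∀ c u → 64 * c * u ≡ 32 * (2 * c * u)
  lemma = solve-∀
  lemma′ : ∀ b r → 32 * (b * r) ≡ b * (32 * r)
  lemma′ = solve-∀
  lemma″ : ∀ b u → b * (14 * u) ≡ 14 * b * u
  lemma″ = solve-∀
  bound : ∀ r → r < 3 → 32 * r < 14 * (4 + r)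
  bound 0 _ = by-evaluation
  bound 1 _ = by-evaluation
  bound 2 _ = by-evaluation
  bound (suc (suc (suc _))) (s≤s (s≤s (s≤s ())))

-- At exponent 3 this reads 47 ≤ 64, at exponent 2 it would read 38 ≤ 32; hence the case distinction
-- at r = 3 in `falls-core`.
linear≤2^ : ∀ k → 9 * (2 + (3 + k)) + 2 ≤ 8 * 2 ^ (3 + k)
linear≤2^ zero    = by-evaluation
linear≤2^ (suc k) = begin
  9 * (2 + (3 + suc k)) + 2                  ≤⟨ m≤m+n _ (9 * k + 38) ⟩
  9 * (2 + (3 + suc k)) + 2 + (9 * k + 38)   ≡⟨ lemma₁ k ⟩
  2 * (9 * (2 + (3 + k)) + 2)                ≤⟨ *-monoʳ-≤ 2 (linear≤2^ k) ⟩
  2 * (8 * 2 ^ (3 + k))                      ≡⟨ lemma₂ (2 ^ (3 + k)) ⟩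
  8 * (2 * 2 ^ (3 + k))                      ∎
  where
  open ≤-Reasoning
  lemma₁ : ∀ k → 9 * (2 + (3 + suc k)) + 2 + (9 * k + 38) ≡ 2 * (9 * (2 + (3 + k)) + 2)
  lemma₁ = solve-∀
  lemma₂ : ∀ x → 2 * (8 * x) ≡ 8 * (2 * x)
  lemma₂ = solve-∀

module _ (r b c δ : ℕ) (0<b : 0 < b) (c≤b : 2 * c * (4 + r) ≤ b * r) (b≤δ : 2 * b ≤ δ * (2 + r)) where
  private
    W = 8 * 2 ^ r
    open ≤-Reasoning

    0<δ : 0 < δ
    0<δ = n≢0⇒n>0 λ { refl → <⇒≱ 0<b (≤-trans (m≤n*m b 2) b≤δ) }

    W-large : 3 ≤ r → 9 * (2 + r) + 2 ≤ W
    W-large 3≤r with k , refl ← m≤n⇒∃[o]m+o≡n 3≤r = linear≤2^ k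

  -- This is what remains of the comparison after substituting a = 2b + δ and cancelling 2Wb + 2b.
  -- For small r the term 64 c is covered by 14 b, for large r by W δ.
  falls-core : 64 * c + δ < W * δ + 14 * b
  falls-core with 3 ≤? r
  ... | no 3≰r  = begin-strict
    64 * c + δ       <⟨ +-monoˡ-< δ (64c<14b r b c (≰⇒> 3≰r) 0<b c≤b) ⟩
    14 * b + δ       ≤⟨ +-monoʳ-≤ (14 * b) (m≤n*m δ W {{m*n≢0 8 (2 ^ r) {{_}} {{m^n≢0 2 r}}}}) ⟩
    14 * b + W * δ   ≡⟨ +-comm (14 * b) (W * δ) ⟩
    W * δ + 14 * b   ∎
  ... | yes 3≤r = begin-strict
    64 * c + δ                       ≡⟨ cong (_+ δ) (*-assoc 32 2 c) ⟩
    32 * (2 * c) + δ                 ≤⟨ +-monoˡ-≤ δ (*-monoʳ-≤ 32 2c≤b) ⟩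
    32 * b + δ                       <⟨ m<m+n (32 * b + δ) 0<δ ⟩
    32 * b + δ + δ                   ≡⟨ lemma₁ b δ ⟩
    -- Of 32 b the part 14 b is kept for the right side; only 9 (2 b) has to be charged to δ.
    9 * (2 * b) + 2 * δ + 14 * b     ≤⟨ +-monoˡ-≤ (14 * b) (+-monoˡ-≤ (2 * δ) (*-monoʳ-≤ 9 b≤δ)) ⟩
    9 * (δ * (2 + r)) + 2 * δ + 14 * b ≡⟨ cong (_+ 14 * b) (lemma₂ δ r) ⟩
    (9 * (2 + r) + 2) * δ + 14 * b   ≤⟨ +-monoˡ-≤ (14 * b) (*-monoˡ-≤ δ (W-large 3≤r)) ⟩
    W * δ + 14 * b                   ∎
    where
    2c≤b : 2 * c ≤ b
    2c≤b = *-cancelʳ-≤ _ _ (4 + r) (≤-trans c≤b (*-monoʳ-≤ b (m≤n+m r 4)))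
    lemma₁ : ∀ b δ → 32 * b + δ + δ ≡ 9 * (2 * b) + 2 * δ + 14 * b
    lemma₁ = solve-∀
    lemma₂ : ∀ δ r → 9 * (δ * (2 + r)) + 2 * δ ≡ (9 * (2 + r) + 2) * δ
    lemma₂ = solve-∀

falls-from : ∀ r a b c → 0 < b → 2 * c * (4 + r) ≤ b * r → 2 * b * (3 + r) ≤ a * (2 + r) →
             2 * (8 * 2 ^ r) * b + 64 * c + a < 8 * 2 ^ r * a + 16 * b
falls-from r a b c 0<b c≤b b≤a = conclude (m≤n⇒∃[o]m+o≡n 2b≤a)
  where
  open ≤-Reasoning
  W = 8 * 2 ^ r
  2b≤a : 2 * b ≤ a
  2b≤a = *-cancelʳ-≤ (2 * b) a (2 + r) (≤-trans (*-monoʳ-≤ (2 * b) (n≤1+n (2 + r))) b≤a)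
  b≤δ : ∀ δ → 2 * b + δ ≡ a → 2 * b ≤ δ * (2 + r)
  b≤δ δ e = +-cancelˡ-≤ (2 * b * (2 + r)) _ _ (begin
    2 * b * (2 + r) + 2 * b        ≡⟨ lemma₃ b r ⟩
    2 * b * (3 + r)                ≤⟨ b≤a ⟩
    a * (2 + r)                    ≡⟨ cong (_* (2 + r)) e ⟨
    (2 * b + δ) * (2 + r)          ≡⟨ *-distribʳ-+ (2 + r) (2 * b) δ ⟩
    2 * b * (2 + r) + δ * (2 + r)  ∎)
    where
    lemma₃ : ∀ b r → 2 * b * (2 + r) + 2 * b ≡ 2 * b * (3 + r)
    lemma₃ = solve-∀
  lemma₁ : ∀ W b c δ → 2 * W * b + 64 * c + (2 * b + δ) ≡ 2 * W * b + 2 * b + (64 * c + δ)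
  lemma₁ = solve-∀
  lemma₂ : ∀ W b δ → 2 * W * b + 2 * b + (W * δ + 14 * b) ≡ W * (2 * b + δ) + 16 * b
  lemma₂ = solve-∀
  conclude : ∃[ δ ] 2 * b + δ ≡ a → 2 * W * b + 64 * c + a < W * a + 16 * b
  conclude (δ , e) = subst (λ a → 2 * W * b + 64 * c + a < W * a + 16 * b) e (begin-strict
    2 * W * b + 64 * c + (2 * b + δ)       ≡⟨ lemma₁ W b c δ ⟩
    2 * W * b + 2 * b + (64 * c + δ)
      <⟨ +-monoʳ-< (2 * W * b + 2 * b) (falls-core r b c δ 0<b c≤b (b≤δ δ e)) ⟩
    2 * W * b + 2 * b + (W * δ + 14 * b)   ≡⟨ lemma₂ W b δ ⟩
    W * (2 * b + δ) + 16 * b               ∎)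

falls : ∀ r j → let i = suc r + j ; W = 8 * 2 ^ r in
        2 * W * L (2 + r) (2 + i) + 64 * L r (3 + i) + L (4 + r) (1 + i) < W * L (4 + r) (1 + i) + 16 * L (2 + r) (2 + i)
falls r j = falls-from r (L (4 + r) (1 + i)) (L (2 + r) (2 + i)) (L r (3 + i))
  (L-positive (1 + r) (2 + i)) (falls-c≤b r j) (falls-b≤a r j)
  where
  i = suc r + j

-- Location of the peak

2*⌊n/2⌋≤n : ∀ n → ⌊ n /2⌋ * 2 ≤ n
2*⌊n/2⌋≤n zero          = z≤n
2*⌊n/2⌋≤n (suc zero)    = z≤n
2*⌊n/2⌋≤n (suc (suc n)) = s≤s (s≤s (2*⌊n/2⌋≤n n))

*2≤⇒≤⌊/2⌋ : ∀ k n → k * 2 ≤ n → k ≤ ⌊ n /2⌋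
*2≤⇒≤⌊/2⌋ zero    n             _             = z≤n
*2≤⇒≤⌊/2⌋ (suc k) (suc (suc n)) (s≤s (s≤s p)) = s≤s (*2≤⇒≤⌊/2⌋ k n p)

-- Genus 0 has its own closed form, so this step lies outside `rises`. It reduces to x + l < x l
-- with x ≥ 2 and l ≥ 3.
rises-first : ∀ k → #sqm (3 + k) 0 < #sqm (3 + k) 1
rises-first k = +-cancelʳ-< (2 * (1 * l)) _ _ (begin-strict
  #sqm (3 + k) 0 + 2 * (1 * l)             ≡⟨ cong (_+ 2 * (1 * l)) (#sqm-zero (3 + k)) ⟩
  2 * (2 * x) + 2 * l + 2 * (1 * l)        ≡⟨ lemma₁ x l ⟩
  4 * (x + l)                              <⟨ *-monoʳ-< 4 (sum<product x l 2≤x 3≤l) ⟩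
  4 * (x * l)                              ≡⟨ lemma₂ x l ⟩
  2 * (1 * (2 * x * l + 8 * 0))
    ≤⟨ *-monoʳ-≤ 2 (*-monoʳ-≤ 1 (+-monoʳ-≤ (2 * x * l) (z≤n {8 * L (suc k) 2}))) ⟩
  2 * (1 * (2 * x * l + 8 * L (suc k) 2))  ≡⟨ #sqm-closed 0 (suc k) ⟨
  #sqm (3 + k) 1 + 2 * (1 * l)             ∎)
  where
  open ≤-Reasoning
  x = 2 ^ suc k
  l = L (3 + k) 1
  2≤x : 2 ≤ x
  2≤x = *-monoʳ-≤ 2 (≤-trans (s≤s z≤n) (suc≤2^ k))
  3≤l : 3 ≤ l
  3≤l = ≤-trans (m≤n+m 3 (2 * k + 2)) (≤-reflexive (trans (lemma k) (sym (L-one (2 + k)))))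
    where
    lemma : ∀ k → 2 * k + 2 + 3 ≡ 2 * (2 + k) + 1
    lemma = solve-∀
  sum<product : ∀ x l → 2 ≤ x → 3 ≤ l → x + l < x * l
  sum<product x l 2≤x 3≤l with x′ , refl ← m≤n⇒∃[o]m+o≡n 2≤x | l′ , refl ← m≤n⇒∃[o]m+o≡n 3≤l =
    ≤-trans (m≤m+n _ (2 * x′ + l′ + x′ * l′)) (≤-reflexive (lemma x′ l′))
    where
    lemma : ∀ x l → suc (2 + x + (3 + l)) + (2 * x + l + x * l) ≡ (2 + x) * (3 + l)
    lemma = solve-∀
  lemma₁ : ∀ x l → 2 * (2 * x) + 2 * l + 2 * (1 * l) ≡ 4 * (x + l)
  lemma₁ = solve-∀
  lemma₂ : ∀ x l → 4 * (x * l) ≡ 2 * (1 * (2 * x * l + 8 * 0))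
  lemma₂ = solve-∀

#sqm-rises : ∀ n i → i * 3 < n → 3 ≤ n → n ≢ 4 → n ≢ 7 → #sqm n i < #sqm n (suc i)
#sqm-rises n zero    _ 3≤n _ _ with k , refl ← m≤n⇒∃[o]m+o≡n 3≤n = rises-first k
#sqm-rises n (suc i) p _ n≢4 n≢7 with j , refl ← m≤n⇒∃[o]m+o≡n p =
  -- With n = 3 (i + 1) + 1 + j the surplus n - 2 (i + 2) is i + j, as `rises` expects.
  subst (λ n → #sqm n (1 + i) < #sqm n (2 + i)) (lemma i j) (step-rises i (i + j) (rises i j (ok i j n≢4 n≢7)))
  where
  lemma : ∀ i j → suc (suc i) * 2 + (i + j) ≡ suc (suc i * 3) + j
  lemma = solve-∀
  ok : ∀ i j → suc (suc i * 3) + j ≢ 4 → suc (suc i * 3) + j ≢ 7 → 1 ≤ j ⊎ 2 ≤ i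
  ok i             (suc j) _ _ = inj₁ (s≤s z≤n)
  ok zero          zero    e _ = ⊥-elim (e refl)
  ok (suc zero)    zero    _ e = ⊥-elim (e refl)
  ok (suc (suc i)) zero    _ _ = inj₂ (s≤s (s≤s z≤n))

remainder<index : ∀ {n} i r → suc (suc i) * 2 + r ≡ n → n ≤ suc i * 3 → suc r ≤ i
remainder<index i r refl n≤3i = +-cancelʳ-≤ (3 + i * 2) _ _ (begin
  suc r + (3 + i * 2)    ≡⟨ lemma₁ i r ⟩
  suc (suc i) * 2 + r    ≤⟨ n≤3i ⟩
  suc i * 3              ≡⟨ lemma₂ i ⟩
  i + (3 + i * 2)        ∎)
  where
  open ≤-Reasoning
  lemma₁ : ∀ i r → suc r + (3 + i * 2) ≡ suc (suc i) * 2 + r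
  lemma₁ = solve-∀
  lemma₂ : ∀ i → suc i * 3 ≡ i + (3 + i * 2)
  lemma₂ = solve-∀

#sqm-falls : ∀ n i → 0 < n → n ≤ i * 3 → suc i ≤ ⌊ n /2⌋ → #sqm n (suc i) < #sqm n i
#sqm-falls n zero    0<n n≤0 _ = ⊥-elim (<⇒≱ 0<n n≤0)
#sqm-falls n (suc i) _   n≤3i i<n/2
  with r , e ← m≤n⇒∃[o]m+o≡n (≤-trans (*-monoˡ-≤ 2 i<n/2) (2*⌊n/2⌋≤n n))
  with j , refl ← m≤n⇒∃[o]m+o≡n (remainder<index i r e n≤3i)
  = subst (λ n → #sqm n (2 + (suc r + j)) < #sqm n (1 + (suc r + j))) e (step-falls (suc r + j) r (falls r j))

#sqm-suc-positive : ∀ i r → 0 < #sqm (suc i * 2 + r) (suc i)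
#sqm-suc-positive i r = +-cancelʳ-< (2 * (y * l)) _ _ (begin-strict
  2 * (y * l)
    <⟨ *-monoʳ-< 2 (*-monoʳ-< y {{m^n≢0 8 i}} (<-≤-trans l<2xl (m≤m+n _ _))) ⟩
  2 * (y * (2 * 2 ^ r * l + 8 * L r (2 + i)))          ≡⟨ #sqm-closed i r ⟨
  #sqm (suc i * 2 + r) (suc i) + 2 * (y * l)           ∎)
  where
  open ≤-Reasoning
  y = 8 ^ i
  l = L (2 + r) (suc i)
  l<2xl : l < 2 * 2 ^ r * l
  l<2xl = <-≤-trans (m<m*n l (2 * 2 ^ r) {{>-nonZero (L-positive (suc r) (suc i))}} (*-monoʳ-≤ 2 (m^n>0 2 r)))
            (≤-reflexive (*-comm l (2 * 2 ^ r)))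

#sqm-positive : ∀ n i → i ≤ ⌊ n /2⌋ → 0 < #sqm n i
#sqm-positive n zero    _ = ≤-trans (m^n>0 2 n) (≤-trans (m≤m+n _ _) (≤-reflexive (sym (#sqm-zero n))))
#sqm-positive n (suc i) p with r , refl ← m≤n⇒∃[o]m+o≡n (≤-trans (*-monoˡ-≤ 2 p) (2*⌊n/2⌋≤n n)) =
  #sqm-suc-positive i r

peak : ∀ {c : ℕ → ℕ} {r p} → p ≤ r → (∀ i → i < p → c i < c (suc i)) →
       (∀ i → p ≤ i → i < r → c (suc i) < c i) → IsPeak c 0 r p
peak {p = p} p≤r up down = record
  { q≤l     = z≤n
  ; l≤m     = ≤-refl
  ; m≤r     = p≤r
  ; ascent  = λ i _ i<p → <⇒≤ (up i (<⇒≤ i<p))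
  ; rise    = λ { i _ refl → up i ≤-refl }
  ; plateau = λ i p≤i i<p → ⊥-elim (<⇒≱ i<p p≤i)
  ; fall    = λ p<r → down p ≤-refl p<r
  ; descent = λ i p<i i<r → <⇒≤ (down i (<⇒≤ p<i) i<r)
  }

-- (n + 2) / 3 is n / 3 rounded up, the least i with n ≤ 3 i, where rising turns into falling.
#sqm-peak : ∀ n → 3 ≤ n → n ≢ 4 → n ≢ 7 → IsPeak (#sqm n) 0 ⌊ n /2⌋ ((n + 2) / 3)
#sqm-peak n 3≤n n≢4 n≢7 = peak {c = #sqm n}
  (*2≤⇒≤⌊/2⌋ p n (p*2≤n p (m/n*n≤m (n + 2) 3)))
  (λ i i<p → #sqm-rises n i (+-cancelʳ-≤ 2 _ _ (≤-trans (≤-trans (≤-reflexive (lemma i)) (*-monoˡ-≤ 3 i<p)) (m/n*n≤m (n + 2) 3))) 3≤n n≢4 n≢7)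
  (λ i p≤i → #sqm-falls n i (≤-trans (s≤s z≤n) 3≤n) (n≤3i i p≤i))
  where
  p = (n + 2) / 3
  lemma : ∀ i → suc (i * 3) + 2 ≡ suc i * 3
  lemma = solve-∀
  p*2≤n : ∀ p → p * 3 ≤ n + 2 → p * 2 ≤ n
  p*2≤n zero          _ = z≤n
  p*2≤n (suc zero)    _ = <⇒≤ 3≤n
  p*2≤n (suc (suc p)) h = +-cancelʳ-≤ 2 _ _ (≤-trans (≤-trans (m≤m+n _ p) (≤-reflexive (lemma′ p))) h)
    where
    lemma′ : ∀ p → suc (suc p) * 2 + 2 + p ≡ suc (suc p) * 3
    lemma′ = solve-∀
  n≤3i : ∀ i → p ≤ i → n ≤ i * 3
  n≤3i i p≤i = +-cancelʳ-≤ 2 _ _ (begin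
    n + 2                     ≡⟨ m≡m%n+[m/n]*n (n + 2) 3 ⟩
    (n + 2) % 3 + p * 3       ≤⟨ +-mono-≤ (<⇒≤pred (m%n<n (n + 2) 3)) (*-monoˡ-≤ 3 p≤i) ⟩
    2 + i * 3                 ≡⟨ +-comm 2 (i * 3) ⟩
    i * 3 + 2                 ∎)
    where open ≤-Reasoning

-- For n = 1, 2, 4, 7 the exceptional comparison places the peak one below (n + 2) / 3, so these
-- cases are evaluated directly. For n = 3, 5, 6 the two formulas have the same value.
#sqm-peak-p₃ : ∀ n → 1 ≤ n → IsPeak (#sqm n) 0 ⌊ n /2⌋ (p₃ n)
#sqm-peak-p₃ 1 _ = peak {c = #sqm 1} z≤n (λ _ ()) (λ _ _ ())
#sqm-peak-p₃ 2 _ = peak {c = #sqm 2} z≤n (λ _ ()) λ { zero _ _ → by-evaluation ; (suc _) _ (s≤s ()) }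
#sqm-peak-p₃ 3 _ = #sqm-peak 3 (s≤s (s≤s (s≤s z≤n))) (λ ()) (λ ())
#sqm-peak-p₃ 4 _ = peak {c = #sqm 4} (s≤s z≤n)
  (λ { zero _ → by-evaluation ; (suc _) (s≤s ()) })
  (λ { 1 _ _ → by-evaluation ; (suc (suc _)) _ (s≤s (s≤s ())) })
#sqm-peak-p₃ 5 _ = #sqm-peak 5 (s≤s (s≤s (s≤s z≤n))) (λ ()) (λ ())
#sqm-peak-p₃ 6 _ = #sqm-peak 6 (s≤s (s≤s (s≤s z≤n))) (λ ()) (λ ())
#sqm-peak-p₃ 7 _ = peak {c = #sqm 7} (s≤s (s≤s z≤n))
  (λ { 0 _ → by-evaluation ; 1 _ → by-evaluation ; (suc (suc _)) (s≤s (s≤s ())) })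
  (λ { 1 (s≤s ()) _ ; 2 _ _ → by-evaluation ; (suc (suc (suc _))) _ (s≤s (s≤s (s≤s ()))) })
#sqm-peak-p₃ (suc (suc (suc (suc (suc (suc (suc (suc k)))))))) _ =
  #sqm-peak (8 + k) (s≤s (s≤s (s≤s z≤n))) (λ ()) (λ ())

peak-cong : ∀ {c c′ r p} → (∀ i → c i ≡ c′ i) → IsPeak c 0 r p → IsPeak c′ 0 r p
peak-cong e P = record
  { q≤l     = q≤l
  ; l≤m     = l≤m
  ; m≤r     = m≤r
  ; ascent  = λ i x y → subst₂ _≤_ (e _) (e _) (ascent i x y)
  ; rise    = λ i x y → subst₂ _<_ (e _) (e _) (rise i x y)
  ; plateau = λ i x y → trans (sym (e _)) (trans (plateau i x y) (e _))
  ; fall    = λ x → subst₂ _<_ (e _) (e _) (fall x)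
  ; descent = λ i x y → subst₂ _≤_ (e _) (e _) (descent i x y)
  }
  where open UnimodalWithModes P

-- The range of genera

filter-nonempty : ∀ {A : Set} {P : A → Set} (P? : Unary.Decidable P) xs → 0 < length (filter P? xs) → Any P xs
filter-nonempty P? xs h with any? P? xs
... | yes p = p
... | no ¬p = ⊥-elim (<⇒≢ h (sym (cong length (filter-none P? (¬Any⇒All¬ xs ¬p)))))

genus-attained : ∀ n i → i ≤ ⌊ suc n /2⌋ → Any (λ S → HasGenus S i) (𝒮₃ (suc n))
genus-attained n i h = filter-nonempty (λ S → hasGenus? S i) (𝒮₃ (suc n))
  (subst (0 <_) (sym (g₃-paths n i)) (#sqm-positive (suc n) i h))

orbits>0 : ∀ σ → 0 < orbits σ
orbits>0 qms = s≤s z≤n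
orbits>0 qsm = s≤s z≤n
orbits>0 mqs = s≤s z≤n
orbits>0 msq = s≤s z≤n
orbits>0 sqm = s≤s z≤n
orbits>0 smq = s≤s z≤n

-- A permutation of the marks has at least one orbit, so at least 1 is left for the vertex term in
-- `genus-euler`.
genus-bound : ∀ {n} (K T : Subset n) → genus K T ≤ ⌊ n /2⌋
genus-bound {n} K T = *2≤⇒≤⌊/2⌋ _ n (+-cancelˡ-≤ 1 _ _ (begin
  1 + genus K T * 2
    ≤⟨ +-mono-≤ (≤-trans (orbits>0 (arcs K T)) (m≤n+m _ (cycles K T))) (≤-reflexive (*-comm (genus K T) 2)) ⟩
  cycles K T + orbits (arcs K T) + 2 * genus K T ≡⟨ genus-euler K T ⟩
  suc n                                          ∎))
  where open ≤-Reasoning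

genus-bounded : ∀ n → All (λ S → ∀ i → HasGenus S i → i ≤ ⌊ suc n /2⌋) (𝒮₃ (suc n))
genus-bounded n = All.tabulate λ {S} S∈ i h → bound S∈ i h
  where
  bound : ∀ {S} → S ∈ 𝒮₃ (suc n) → ∀ i → HasGenus S i → i ≤ ⌊ suc n /2⌋
  bound S∈ i h with K , T , _ , _ , refl ← ∈-cartesianProductWith⁻ ladder (subsets (suc n)) (subsets (suc n)) S∈ =
    subst (_≤ ⌊ suc n /2⌋) (hasGenus⁻ K T h) (genus-bound K T)

theorem3p9 : ∀ (n : ℕ) → 1 ≤ n →
    ∃₂ λ q r → IsMinGenus (𝒮₃ n) q × IsMaxGenus (𝒮₃ n) r ×
    Unimodal (g₃ n) q r × IsPeak (g₃ n) q r (p₃ n)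
theorem3p9 (suc n) 1≤n =
  0 , ⌊ suc n /2⌋ ,
  (genus-attained n 0 z≤n , All.tabulate λ _ _ _ → z≤n) ,
  (genus-attained n _ ≤-refl , genus-bounded n) ,
  (_ , _ , isPeak) , isPeak
  where
  isPeak : IsPeak (g₃ (suc n)) 0 ⌊ suc n /2⌋ (p₃ (suc n))
  isPeak = peak-cong (λ i → sym (g₃-paths n i)) (#sqm-peak-p₃ (suc n) 1≤n)
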